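{- Let $g \ge 4$ and $r\ge 3$ be integers. Then $$\inf_{G \in G(g,r)} \frac{|\mathcal{I}(G)|}{|V(G)|} \ge \frac{1 - (r-1)^{ -\frac{2}{r-2}}}{2} - \frac{r(r-1)^{\lfloor \frac{g-2}{2} \rfloor }}{(\lfloor \frac{g-2}{2} \rfloor+1)!},$$ where $|\mathcal{I}(G)|$ denotes the cardinality of a maximum cardinality independent set of $G$.
   Context: All graphs are finite, simple and undirected; $V(G)$ is the node set of $G$. The girth of a graph is the length of its shortest cycle. $G(g,r)$ is the family of all $r$-regular graphs (every node has degree exactly $r$) with girth at least $g$. -}

module Defs where

import Algebra.Definitions.RawSemiring
open import Data.Empty using (⊥)
open import Data.Fin.Base as Fin using (Fin; inject₁; fromℕ)
import Data.Fin.Properties as Fin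
open import Data.Fin.Subset using (Subset; _∈_; _∉_; ∣_∣) renaming (⊥ to ∅)
open import Data.Fin.Subset.Properties using (_∈?_; anySubset?; ∣p∣≤n; ∉⊥)
open import Data.Integer.Base as ℤ using (ℤ; +_; -[1+_])
open import Data.Nat.Base as ℕ using (ℕ; zero; suc; _∸_; _!)
open import Data.Nat.DivMod using () renaming (_/_ to _div_)
import Data.Nat.Properties as ℕ
open import Data.Product using (∃; _×_; _,_; proj₁; proj₂)
open import Data.Rational
  using (ℚ; 0ℚ; 1ℚ; _+_; _*_; _-_; -_; _/_; 1/_; _<_; _⊓_; _⊔_; ↥_; ↧ₙ_; Positive; NonNegative; NonZero; positive; nonNegative)
import Data.Rational as ℚ
import Data.Rational.Properties as ℚ
open import Data.Sum using (_⊎_; inj₁; inj₂; swap)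
open import Function.Definitions using (Injective)
open import Relation.Binary.Definitions using (tri<; tri≈; tri>)
open import Relation.Binary.PropositionalEquality using (_≡_; refl; sym; trans; cong; subst; subst₂)
open import Relation.Nullary using (¬_; Dec; yes; no; contradiction)
open import Relation.Nullary.Decidable using (_×-dec_; _→-dec_; ¬?)

open Algebra.Definitions.RawSemiring ℚ.+-*-rawSemiring using (_^_)

-- Finite simple graphs on the (nonempty) node set Fin order; u and v are
-- adjacent when v ∈ nbhd u.

record Graph : Set where
  field
    order       : ℕ
    {{nonempty}} : ℕ.NonZero order
    nbhd        : Fin order → Subset order
    symmetric   : ∀ {u v} → v ∈ nbhd u → u ∈ nbhd v
    irreflexive : ∀ {u} → u ∉ nbhd u

  Node : Set
  Node = Fin order

  _~_ : Node → Node → Set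
  u ~ v = v ∈ nbhd u

  degree : Node → ℕ
  degree u = ∣ nbhd u ∣

open Graph using (order; degree)

IsRegular : ℕ → Graph → Set
IsRegular r G = ∀ u → degree G u ≡ r

-- A cycle with 1 + lastIndex nodes.

record Cycle (G : Graph) : Set where
  open Graph G using (Node; _~_)
  field
    lastIndex : ℕ
    node      : Fin (suc lastIndex) → Node
    distinct  : Injective _≡_ _≡_ node
    step      : ∀ i → node (inject₁ i) ~ node (Fin.suc i)
    closing   : node (fromℕ lastIndex) ~ node Fin.zero
    length≥3  : 3 ℕ.≤ suc lastIndex

  length : ℕ
  length = suc lastIndex

-- The girth, being the length of a shortest cycle (∞ if there is none),
-- is at least g.

GirthAtLeast : ℕ → Graph → Set
GirthAtLeast g G = (c : Cycle G) → g ℕ.≤ Cycle.length c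

record 𝓖 (g r : ℕ) : Set where
  field
    graph   : Graph
    regular : IsRegular r graph
    girth   : GirthAtLeast g graph

module _ (G : Graph) where
  open Graph G using (Node; _~_)

  Independent : Subset (order G) → Set
  Independent S = ∀ u v → u ∈ S → v ∈ S → ¬ (u ~ v)

  IsMaximumIndependent : Subset (order G) → Set
  IsMaximumIndependent S = Independent S × (∀ T → Independent T → ∣ T ∣ ℕ.≤ ∣ S ∣)

  independent? : ∀ S → Dec (Independent S)
  independent? S = Fin.all? λ u → Fin.all? λ v →
    (u ∈? S) →-dec ((v ∈? S) →-dec ¬? (v ∈? Graph.nbhd G u))

  private
    search : ∀ k → (∀ T → Independent T → ∣ T ∣ ℕ.≤ k) → ∃ IsMaximumIndependent
    search zero    bd = ∅ , (λ _ _ u∈ _ _ → ∉⊥ u∈) ,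
                        λ T T-ind → ℕ.≤-trans (bd T T-ind) ℕ.z≤n
    search (suc k) bd
      with anySubset? (λ S → independent? S ×-dec (∣ S ∣ ℕ.≟ suc k))
    ... | yes (S , S-ind , ∣S∣≡) = S , S-ind , λ T T-ind →
          subst (∣ T ∣ ℕ.≤_) (sym ∣S∣≡) (bd T T-ind)
    ... | no ∄S = search k λ T T-ind →
          ℕ.≤-pred (ℕ.≤∧≢⇒< (bd T T-ind) λ ∣T∣≡ → ∄S (T , T-ind , ∣T∣≡))

  maximumIndependentSet : ∃ IsMaximumIndependent
  maximumIndependentSet = search (order G) λ T _ → ∣p∣≤n T

  𝓘 : Subset (order G)
  𝓘 = proj₁ maximumIndependentSet

  independenceRatio : ℚ
  independenceRatio = + ∣ 𝓘 ∣ / order G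

record ℝ : Set₁ where
  field
    L U : ℚ → Set          -- L q is q < x, and U q is x < q
    L-inhabited : ∃ L
    U-inhabited : ∃ U
    L-closed    : ∀ {p q} → p < q → L q → L p
    U-closed    : ∀ {p q} → p < q → U p → U q
    L-open      : ∀ {p} → L p → ∃ λ q → p < q × L q
    U-open      : ∀ {q} → U q → ∃ λ p → p < q × U p
    disjoint    : ∀ {q} → L q → U q → ⊥
    located     : ∀ {p q} → p < q → L p ⊎ U q

open ℝ

private
  p<p+1 : ∀ p → p < p + 1ℚ
  p<p+1 p = subst (_< p + 1ℚ) (ℚ.+-identityʳ p) (ℚ.+-monoʳ-< p (ℚ.positive⁻¹ 1ℚ))

  p-1<p : ∀ p → p - 1ℚ < p
  p-1<p p = subst (p - 1ℚ <_) (ℚ.+-identityʳ p) (ℚ.+-monoʳ-< p (ℚ.negative⁻¹ (- 1ℚ)))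

  p-[p-q]≡q : ∀ p q → p - (p - q) ≡ q
  p-[p-q]≡q p q = trans (cong (λ z → p + z)
      (trans (ℚ.neg-distrib-+ p (- q)) (cong (λ z → - p + z) (neg-neg q))))
    (trans (sym (ℚ.+-assoc p (- p) q))
      (trans (cong (_+ q) (ℚ.+-inverseʳ p)) (ℚ.+-identityˡ q)))
    where
    open import Algebra.Properties.Group ℚ.+-0-group using () renaming (⁻¹-involutive to neg-neg)

  p+q-q≡p : ∀ p q → (p + q) - q ≡ p
  p+q-q≡p p q = trans (ℚ.+-assoc p q (- q)) (trans (cong (λ z → p + z) (ℚ.+-inverseʳ q)) (ℚ.+-identityʳ p))

  p-q+q≡p : ∀ p q → (p - q) + q ≡ p
  p-q+q≡p p q = trans (ℚ.+-assoc p (- q) q) (trans (cong (λ z → p + z) (ℚ.+-inverseˡ q)) (ℚ.+-identityʳ p))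

  flip< : ∀ c {p q} → p < q → c - q < c - p
  flip< c p<q = ℚ.+-monoʳ-< c (ℚ.neg-antimono-< p<q)

  flip<ˡ : ∀ c {p q} → c - p < q → c - q < p
  flip<ˡ c {p} {q} h = subst (c - q <_) (p-[p-q]≡q c p) (flip< c h)

  flip<ʳ : ∀ c {p q} → p < c - q → q < c - p
  flip<ʳ c {p} {q} h = subst (_< c - p) (p-[p-q]≡q c q) (flip< c h)

  shift<ʳ : ∀ c {p q} → p + c < q → p < q - c
  shift<ʳ c {p} {q} h = subst (_< q - c) (p+q-q≡p p c) (ℚ.+-monoˡ-< (- c) h)

  shift<ˡ : ∀ c {p q} → p < q + c → p - c < q
  shift<ˡ c {p} {q} h = subst (p - c <_) (p+q-q≡p q c) (ℚ.+-monoˡ-< (- c) h)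

fromℚ : ℚ → ℝ
fromℚ c .L q = q < c
fromℚ c .U q = c < q
fromℚ c .L-inhabited = _ , p-1<p c
fromℚ c .U-inhabited = _ , p<p+1 c
fromℚ c .L-closed = ℚ.<-trans
fromℚ c .U-closed p<q c<p = ℚ.<-trans c<p p<q
fromℚ c .L-open p<c with q , p<q , q<c ← ℚ.<-dense p<c = q , p<q , q<c
fromℚ c .U-open c<q with p , c<p , p<q ← ℚ.<-dense c<q = p , p<q , c<p
fromℚ c .disjoint = ℚ.<-asym
fromℚ c .located {p} {q} p<q with p ℚ.<? c
... | yes p<c = inj₁ p<c
... | no  p≮c = inj₂ (ℚ.≤-<-trans (ℚ.≮⇒≥ p≮c) p<q)

infixl 6 _ℚ-_ _-ℚ_
infixl 7 _/ℚ_

_ℚ-_ : ℚ → ℝ → ℝ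
(c ℚ- x) .L q = x .U (c - q)
(c ℚ- x) .U q = x .L (c - q)
(c ℚ- x) .L-inhabited with u , Uu ← x .U-inhabited =
  c - u , subst (x .U) (sym (p-[p-q]≡q c u)) Uu
(c ℚ- x) .U-inhabited with l , Ll ← x .L-inhabited =
  c - l , subst (x .L) (sym (p-[p-q]≡q c l)) Ll
(c ℚ- x) .L-closed p<q = x .U-closed (flip< c p<q)
(c ℚ- x) .U-closed p<q = x .L-closed (flip< c p<q)
(c ℚ- x) .L-open Up with u , u< , Uu ← x .U-open Up =
  c - u , flip<ʳ c u< , subst (x .U) (sym (p-[p-q]≡q c u)) Uu
(c ℚ- x) .U-open Lq with l , <l , Ll ← x .L-open Lq =
  c - l , flip<ˡ c <l , subst (x .L) (sym (p-[p-q]≡q c l)) Ll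
(c ℚ- x) .disjoint Uq Lq = x .disjoint Lq Uq
(c ℚ- x) .located p<q = swap (x .located (flip< c p<q))

_-ℚ_ : ℝ → ℚ → ℝ
(x -ℚ c) .L q = x .L (q + c)
(x -ℚ c) .U q = x .U (q + c)
(x -ℚ c) .L-inhabited with l , Ll ← x .L-inhabited =
  l - c , subst (x .L) (sym (p-q+q≡p l c)) Ll
(x -ℚ c) .U-inhabited with u , Uu ← x .U-inhabited =
  u - c , subst (x .U) (sym (p-q+q≡p u c)) Uu
(x -ℚ c) .L-closed p<q = x .L-closed (ℚ.+-monoˡ-< c p<q)
(x -ℚ c) .U-closed p<q = x .U-closed (ℚ.+-monoˡ-< c p<q)
(x -ℚ c) .L-open Lp with l , <l , Ll ← x .L-open Lp =
  l - c , shift<ʳ c <l , subst (x .L) (sym (p-q+q≡p l c)) Ll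
(x -ℚ c) .U-open Uq with u , u< , Uu ← x .U-open Uq =
  u - c , shift<ˡ c u< , subst (x .U) (sym (p-q+q≡p u c)) Uu
(x -ℚ c) .disjoint = x .disjoint
(x -ℚ c) .located p<q = x .located (ℚ.+-monoˡ-< c p<q)

module _ (c : ℚ) .{{c>0 : Positive c}} where

  private
    instance
      c≢0 : NonZero c
      c≢0 = ℚ.pos⇒nonZero c

    c≥0 : NonNegative c
    c≥0 = ℚ.pos⇒nonNeg c

    q/c*c≡q : ∀ q → (q * 1/ c) * c ≡ q
    q/c*c≡q q = trans (ℚ.*-assoc q (1/ c) c)
      (trans (cong (q *_) (ℚ.*-inverseˡ c)) (ℚ.*-identityʳ q))

    <q/c : ∀ {p q} → p * c < q → p < q * 1/ c
    <q/c {p} {q} h = ℚ.*-cancelʳ-<-nonNeg c {{c≥0}} (subst (p * c <_) (sym (q/c*c≡q q)) h)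

    q/c< : ∀ {p q} → q < p * c → q * 1/ c < p
    q/c< {p} {q} h = ℚ.*-cancelʳ-<-nonNeg c {{c≥0}} (subst (_< p * c) (sym (q/c*c≡q q)) h)

  divideBy : ℝ → ℝ
  divideBy x .L q = x .L (q * c)
  divideBy x .U q = x .U (q * c)
  divideBy x .L-inhabited with l , Ll ← x .L-inhabited =
    l * 1/ c , subst (x .L) (sym (q/c*c≡q l)) Ll
  divideBy x .U-inhabited with u , Uu ← x .U-inhabited =
    u * 1/ c , subst (x .U) (sym (q/c*c≡q u)) Uu
  divideBy x .L-closed p<q = x .L-closed (ℚ.*-monoˡ-<-pos c p<q)
  divideBy x .U-closed p<q = x .U-closed (ℚ.*-monoˡ-<-pos c p<q)
  divideBy x .L-open Lp with l , <l , Ll ← x .L-open Lp =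
    l * 1/ c , <q/c <l , subst (x .L) (sym (q/c*c≡q l)) Ll
  divideBy x .U-open Uq with u , u< , Uu ← x .U-open Uq =
    u * 1/ c , q/c< u< , subst (x .U) (sym (q/c*c≡q u)) Uu
  divideBy x .disjoint = x .disjoint
  divideBy x .located p<q = x .located (ℚ.*-monoˡ-<-pos c p<q)

_/ℚ_ : ℝ → (c : ℚ) .{{_ : Positive c}} → ℝ
x /ℚ c = divideBy c x

private
  ^-nonNeg : ∀ q n → .{{NonNegative q}} → NonNegative (q ^ n)
  ^-nonNeg q zero    = _
  ^-nonNeg q (suc n) = ℚ.nonNeg*nonNeg⇒nonNeg q (q ^ n) {{^-nonNeg q n}}

  ^-pos : ∀ q n → .{{Positive q}} → Positive (q ^ n)
  ^-pos q zero    = _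
  ^-pos q (suc n) = ℚ.pos*pos⇒pos q (q ^ n) {{^-pos q n}}

  *-mono-≤₀ : ∀ {p q r s} → NonNegative p → NonNegative s →
              p ℚ.≤ q → r ℚ.≤ s → p * r ℚ.≤ q * s
  *-mono-≤₀ {p} {q} {r} {s} p≥0 s≥0 p≤q r≤s =
    ℚ.≤-trans (ℚ.*-monoˡ-≤-nonNeg p {{p≥0}} r≤s) (ℚ.*-monoʳ-≤-nonNeg s {{s≥0}} p≤q)

  ^-mono-≤ : ∀ {p q} n → 0ℚ ℚ.≤ p → p ℚ.≤ q → p ^ n ℚ.≤ q ^ n
  ^-mono-≤ zero    p≥0 p≤q = ℚ.≤-refl
  ^-mono-≤ {p} {q} (suc n) p≥0 p≤q =
    *-mono-≤₀ (nonNegative p≥0)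
      (^-nonNeg q n {{nonNegative (ℚ.≤-trans p≥0 p≤q)}}) p≤q (^-mono-≤ n p≥0 p≤q)

  x*[a/x]≡a : ∀ x a .{{_ : NonZero x}} → x * (1/ x * a) ≡ a
  x*[a/x]≡a x a = trans (sym (ℚ.*-assoc x (1/ x) a))
    (trans (cong (_* a) (ℚ.*-inverseʳ x)) (ℚ.*-identityˡ a))

  room-above : ∀ {x y a} → 0ℚ ℚ.≤ x → x * y < a → ∃ λ z → y < z × x * z < a
  room-above {x} {y} {a} x≥0 xy<a with ℚ.<-cmp 0ℚ x
  ... | tri> _ _ x<0 = contradiction (ℚ.<-≤-trans x<0 x≥0) (ℚ.<-irrefl refl)
  ... | tri≈ _ refl _ = y + 1ℚ , p<p+1 y ,
        subst (_< a) (trans (ℚ.*-zeroˡ y) (sym (ℚ.*-zeroˡ (y + 1ℚ)))) xy<a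
  ... | tri< x>0 _ _ = between
    where
    instance
      _ = positive x>0
      _ = ℚ.pos⇒nonZero x
      _ = ℚ.pos⇒nonNeg x
    y<a/x : y < 1/ x * a
    y<a/x = ℚ.*-cancelˡ-<-nonNeg x (subst (x * y <_) (sym (x*[a/x]≡a x a)) xy<a)
    between : ∃ λ z → y < z × x * z < a
    between with z , y<z , z<a/x ← ℚ.<-dense y<a/x =
      z , y<z , subst (x * z <_) (x*[a/x]≡a x a) (ℚ.*-monoʳ-<-pos x z<a/x)

  room-below : ∀ {x y a} → 0ℚ ℚ.≤ a → 0ℚ < x → a < x * y →
               ∃ λ z → 0ℚ < z × z < y × a < x * z
  room-below {x} {y} {a} a≥0 x>0 a<xy = between
    where
    instance
      _ = positive x>0
      _ = ℚ.pos⇒nonZero x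
      _ = ℚ.pos⇒nonNeg x
    a/x<y : 1/ x * a < y
    a/x<y = ℚ.*-cancelˡ-<-nonNeg x (subst (_< x * y) (sym (x*[a/x]≡a x a)) a<xy)
    a/x≥0 : 0ℚ ℚ.≤ 1/ x * a
    a/x≥0 = ℚ.*-cancelˡ-≤-pos x
      (subst₂ ℚ._≤_ (sym (ℚ.*-zeroʳ x)) (sym (x*[a/x]≡a x a)) a≥0)
    between : ∃ λ z → 0ℚ < z × z < y × a < x * z
    between with z , a/x<z , z<y ← ℚ.<-dense a/x<y =
      z , ℚ.≤-<-trans a/x≥0 a/x<z , z<y ,
      subst (_< x * z) (x*[a/x]≡a x a) (ℚ.*-monoʳ-<-pos x a/x<z)

  ⊓-< : ∀ {p} q r → p < q → p < r → p < q ⊓ r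
  ⊓-< q r p<q p<r with ℚ.≤-total q r
  ... | inj₁ q≤r = subst (_ <_) (sym (ℚ.p≤q⇒p⊓q≡p q≤r)) p<q
  ... | inj₂ r≤q = subst (_ <_) (sym (ℚ.p≥q⇒p⊓q≡q r≤q)) p<r

  <-⊔ : ∀ {p} q r → q < p → r < p → q ⊔ r < p
  <-⊔ q r q<p r<p with ℚ.≤-total q r
  ... | inj₁ q≤r = subst (_< _) (sym (ℚ.p≤q⇒p⊔q≡q q≤r)) r<p
  ... | inj₂ r≤q = subst (_< _) (sym (ℚ.p≥q⇒p⊔q≡p r≤q)) q<p

  ^-open-above : ∀ n {q a} → 0ℚ ℚ.≤ q → q ^ n < a → ∃ λ r → q < r × r ^ n < a
  ^-open-above zero    {q} q≥0 1<a = q + 1ℚ , p<p+1 q , 1<a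
  ^-open-above (suc n) {q} {a} q≥0 h
    with b , qⁿ<b , qb<a ← room-above q≥0 h
    with s , q<s , bs<a ← room-above {b} {q} {a}
           (ℚ.<⇒≤ (ℚ.≤-<-trans (ℚ.nonNegative⁻¹ _ {{^-nonNeg q n {{nonNegative q≥0}}}}) qⁿ<b))
           (subst (_< a) (ℚ.*-comm q b) qb<a)
    with t , q<t , tⁿ<b ← ^-open-above n q≥0 qⁿ<b
    = s ⊓ t , q<m , ℚ.≤-<-trans
        (*-mono-≤₀ (nonNegative m≥0) (nonNegative b≥0) (ℚ.p⊓q≤p s t)
          (ℚ.≤-trans (^-mono-≤ n m≥0 (ℚ.p⊓q≤q s t)) (ℚ.<⇒≤ tⁿ<b)))
        (subst (_< a) (ℚ.*-comm b s) bs<a)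
    where
    q<m : q < s ⊓ t
    q<m = ⊓-< s t q<s q<t
    m≥0 : 0ℚ ℚ.≤ s ⊓ t
    m≥0 = ℚ.<⇒≤ (ℚ.≤-<-trans q≥0 q<m)
    b≥0 : 0ℚ ℚ.≤ b
    b≥0 = ℚ.<⇒≤ (ℚ.≤-<-trans (ℚ.nonNegative⁻¹ _ {{^-nonNeg q n {{nonNegative q≥0}}}}) qⁿ<b)

  ^-open-below : ∀ n {q a} → 0ℚ ℚ.≤ a → 0ℚ < q → a < q ^ n →
                 ∃ λ r → r < q × 0ℚ < r × a < r ^ n
  ^-open-below zero    a≥0 q>0 a<1 with r , r>0 , r<q ← ℚ.<-dense q>0 = r , r<q , r>0 , a<1
  ^-open-below (suc n) {q} {a} a≥0 q>0 h
    with b , b>0 , b<qⁿ , a<qb ← room-below a≥0 q>0 h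
    with s , s>0 , s<q , a<bs ← room-below {b} {q} {a} a≥0 b>0 (subst (a <_) (ℚ.*-comm q b) a<qb)
    with t , t<q , t>0 , b<tⁿ ← ^-open-below n (ℚ.<⇒≤ b>0) q>0 b<qⁿ
    = s ⊔ t , <-⊔ s t s<q t<q , m>0 , ℚ.<-≤-trans
        (subst (a <_) (ℚ.*-comm b s) a<bs)
        (*-mono-≤₀ (nonNegative (ℚ.<⇒≤ s>0)) (^-nonNeg (s ⊔ t) n {{nonNegative (ℚ.<⇒≤ m>0)}})
          (ℚ.p≤p⊔q s t)
          (ℚ.≤-trans (ℚ.<⇒≤ b<tⁿ) (^-mono-≤ n (ℚ.<⇒≤ t>0) (ℚ.p≤q⊔p s t))))
    where
    m>0 : 0ℚ < s ⊔ t
    m>0 = ℚ.<-≤-trans s>0 (ℚ.p≤p⊔q s t)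

  ^-strict : ∀ n {p q} → 0ℚ ℚ.≤ p → p < q → p ^ suc n < q ^ suc n
  ^-strict n {p} {q} p≥0 p<q = ℚ.≤-<-trans
    (ℚ.*-monoˡ-≤-nonNeg p {{nonNegative p≥0}} (^-mono-≤ n p≥0 (ℚ.<⇒≤ p<q)))
    (ℚ.*-monoˡ-<-pos (q ^ n) {{^-pos q n {{positive (ℚ.≤-<-trans p≥0 p<q)}}}} p<q)

  a<[a+1]^suc : ∀ n {a} → 0ℚ ℚ.≤ a → a < (a + 1ℚ) ^ suc n
  a<[a+1]^suc n {a} a≥0 = ℚ.<-≤-trans (p<p+1 a)
    (subst (ℚ._≤ (a + 1ℚ) ^ suc n) (ℚ.*-identityʳ (a + 1ℚ))
      (ℚ.*-monoˡ-≤-nonNeg (a + 1ℚ) {{nonNegative a+1≥0}} (1≤ n)))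
    where
    a+1≥0 : 0ℚ ℚ.≤ a + 1ℚ
    a+1≥0 = ℚ.<⇒≤ (ℚ.≤-<-trans a≥0 (p<p+1 a))
    1≤a+1 : 1ℚ ℚ.≤ a + 1ℚ
    1≤a+1 = subst (ℚ._≤ a + 1ℚ) (ℚ.+-identityˡ 1ℚ) (ℚ.+-monoˡ-≤ 1ℚ a≥0)
    1≤ : ∀ k → 1ℚ ℚ.≤ (a + 1ℚ) ^ k
    1≤ zero    = ℚ.≤-refl
    1≤ (suc k) = *-mono-≤₀ {1ℚ} {a + 1ℚ} {1ℚ} _ (^-nonNeg (a + 1ℚ) k {{nonNegative a+1≥0}}) 1≤a+1 (1≤ k)

-- The nonnegative real x with x ^ n = a

root : (n : ℕ) .{{_ : ℕ.NonZero n}} (a : ℚ) .{{_ : NonNegative a}} → ℝ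
root n a .L q = q < 0ℚ ⊎ (0ℚ ℚ.≤ q × q ^ n < a)
root n a .U q = 0ℚ < q × a < q ^ n
root n a .L-inhabited = - 1ℚ , inj₁ (ℚ.negative⁻¹ (- 1ℚ))
root n@(suc m) a .U-inhabited = a + 1ℚ , ℚ.≤-<-trans a≥0 (p<p+1 a) , a<[a+1]^suc m a≥0
  where a≥0 = ℚ.nonNegative⁻¹ a
root n a .L-closed p<q (inj₁ q<0) = inj₁ (ℚ.<-trans p<q q<0)
root n a .L-closed {p} p<q (inj₂ (q≥0 , qⁿ<a)) with p ℚ.<? 0ℚ
... | yes p<0 = inj₁ p<0
... | no  p≮0 = inj₂ (ℚ.≮⇒≥ p≮0 , ℚ.≤-<-trans (^-mono-≤ n (ℚ.≮⇒≥ p≮0) (ℚ.<⇒≤ p<q)) qⁿ<a)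
root n a .U-closed p<q (p>0 , a<pⁿ) =
  ℚ.<-trans p>0 p<q , ℚ.<-≤-trans a<pⁿ (^-mono-≤ n (ℚ.<⇒≤ p>0) (ℚ.<⇒≤ p<q))
root n a .L-open (inj₁ p<0) with q , p<q , q<0 ← ℚ.<-dense p<0 = q , p<q , inj₁ q<0
root n a .L-open (inj₂ (p≥0 , pⁿ<a)) with q , p<q , qⁿ<a ← ^-open-above n p≥0 pⁿ<a =
  q , p<q , inj₂ (ℚ.<⇒≤ (ℚ.≤-<-trans p≥0 p<q) , qⁿ<a)
root n a .U-open (q>0 , a<qⁿ) = ^-open-below n (ℚ.nonNegative⁻¹ a) q>0 a<qⁿ
root n a .disjoint (inj₁ q<0)         (q>0 , _)    = ℚ.<-asym q<0 q>0
root n a .disjoint (inj₂ (_ , qⁿ<a)) (_ , a<qⁿ) = ℚ.<-asym qⁿ<a a<qⁿ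
root n@(suc m) a .located {p} {q} p<q with p ℚ.<? 0ℚ
... | yes p<0 = inj₁ (inj₁ p<0)
... | no  p≮0 with p ^ n ℚ.<? a
...   | yes pⁿ<a = inj₁ (inj₂ (ℚ.≮⇒≥ p≮0 , pⁿ<a))
...   | no  pⁿ≮a = inj₂ (ℚ.≤-<-trans (ℚ.≮⇒≥ p≮0) p<q ,
                         ℚ.≤-<-trans (ℚ.≮⇒≥ pⁿ≮a) (^-strict m (ℚ.≮⇒≥ p≮0) p<q))

infixr 8 _^ᶻ_ _^ℚ_

_^ᶻ_ : (b : ℚ) .{{_ : Positive b}} → ℤ → ℚ
b ^ᶻ (+ n)    = b ^ n
b ^ᶻ -[1+ n ] = ((1/ b) {{ℚ.pos⇒nonZero b}}) ^ suc n

^ᶻ-pos : ∀ b .{{_ : Positive b}} k → Positive (b ^ᶻ k)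
^ᶻ-pos b (+ n)    = ^-pos b n
^ᶻ-pos b -[1+ n ] = ^-pos ((1/ b) {{ℚ.pos⇒nonZero b}}) (suc n) {{ℚ.1/pos⇒pos b}}

_^ℚ_ : (b : ℚ) .{{_ : Positive b}} → ℚ → ℝ
b ^ℚ e = root (↧ₙ e) (b ^ᶻ ↥ e) {{ℚ.pos⇒nonNeg (b ^ᶻ ↥ e) {{^ᶻ-pos b (↥ e)}}}}

-- The infimum of a family of reals need not be a constructively located
-- cut, but it always is an upper real, given by the rationals strictly above
-- it.  Classically the upper reals are the extended reals; the empty upper
-- cut is +∞, the infimum of the empty family.

record ℝ↑ : Set₁ where
  field
    U        : ℚ → Set
    U-closed : ∀ {p q} → p < q → U p → U q
    U-open   : ∀ {q} → U q → ∃ λ p → p < q × U p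

upper : ℝ → ℝ↑
upper x = record { U = x .U ; U-closed = x .U-closed ; U-open = x .U-open }

infix 4 _≤↑_

_≤↑_ : ℝ↑ → ℝ↑ → Set
x ≤↑ y = ∀ {q} → ℝ↑.U y q → ℝ↑.U x q

inf : {I : Set} → (I → ℝ) → ℝ↑
inf f .ℝ↑.U q = ∃ λ i → f i .U q
inf f .ℝ↑.U-closed p<q (i , Up) = i , f i .U-closed p<q Up
inf f .ℝ↑.U-open (i , Uq) with p , p<q , Up ← f i .U-open Uq = p , p<q , i , Up

inf-lowerBound : ∀ {I} (f : I → ℝ) i → inf f ≤↑ upper (f i)
inf-lowerBound f i Uq = i , Uq

inf-greatest : ∀ {I} (f : I → ℝ) y → (∀ i → y ≤↑ upper (f i)) → y ≤↑ inf f
inf-greatest f y y≤f (i , Uq) = y≤f i Uq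

module _ (g r : ℕ) (r≥3 : 3 ℕ.≤ r) where

  private
    instance
      r-2≢0 : ℕ.NonZero (r ∸ 2)
      r-2≢0 = ℕ.>-nonZero (ℕ.m<n⇒0<n∸m r≥3)

      r-1>0 : Positive (+ (r ∸ 1) / 1)
      r-1>0 = ℚ.normalize-pos (r ∸ 1) 1 {{_}} {{ℕ.>-nonZero (ℕ.m<n⇒0<n∸m (ℕ.<⇒≤ r≥3))}}

    k : ℕ
    k = (g ∸ 2) div 2

    instance
      [k+1]!≢0 : ℕ.NonZero ((k ℕ.+ 1) !)
      [k+1]!≢0 = (k ℕ.+ 1) ℕ.!≢0

  bound : ℝ
  bound = (1ℚ ℚ- (+ (r ∸ 1) / 1) ^ℚ (ℤ.- + 2 / (r ∸ 2))) /ℚ (+ 2 / 1)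
          -ℚ (+ (r ℕ.* (r ∸ 1) ℕ.^ k) / (k ℕ.+ 1) !)

module Submission where

-- Give the nodes independent weights, uniform on {0, …, N − 1}, and choose nodes
-- greedily in order of increasing weight. Exploring the graph from a node v to
-- depth k < g / 2 one sees a tree, so the decision at v, truncated at that depth
-- towards rejection, has a probability given by an exact recursion; the nodes
-- accepted by the truncated rule are still independent. For the infinite tree the
-- recursion is solved by the Euler scheme z(x + 1) = z(x) − ε z(x)^(r−1), ε = 1/N,
-- of the equation z′ = −z^(r−1). Comparing z² and z^(2−r) along the scheme gives
-- ε ∑ z^r ≥ (z(0)² − z(N)²) / 2 and (r − 1) z(N)^(r−2) ≤ 1, which is the main term.
-- Truncation costs a factor (r − 1) and one iterated sum per level, whence the
-- factorial, and N → ∞ removes the effect of equal weights.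

import Algebra.Definitions.RawSemiring
open import Defs
open import Data.Bool.Base using (Bool; true; false; not; _∧_; T; if_then_else_)
open import Data.Bool.ListAction using (all; and)
open import Data.Bool.Properties using (T-≡)
open import Data.Fin.Base using (Fin; zero; suc; inject₁; fromℕ)
import Data.Fin.Properties as Fin
open import Data.Fin.Subset using (Subset; _∈_) renaming (∣_∣ to card)
open import Data.Integer.Base as ℤ using (+_; -[1+_])
import Data.Integer.GCD as ℤ
import Data.Integer.Properties as ℤ
open import Data.List.Base as List using (List; []; _∷_; _++_; map; filter; length)
import Data.List.Properties as List
open import Data.List.Membership.Propositional using (find) renaming (_∈_ to _∈ˡ_)
open import Data.List.Membership.Propositional.Properties
  using (∈-∃++; ∈-map⁺; ∈-map⁻; ∈-filter⁺; ∈-filter⁻; ∈-lookup)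
open import Data.List.Relation.Binary.Subset.Propositional using (_⊆_)
open import Data.List.Relation.Unary.All as All using (All; []; _∷_)
import Data.List.Relation.Unary.All.Properties as All
open import Data.List.Relation.Unary.AllPairs using (AllPairs; []; _∷_)
open import Data.List.Relation.Unary.Any as Any using (Any; here; there; any?)
open import Data.List.Relation.Unary.Unique.Propositional using (Unique)
import Data.List.Relation.Unary.Unique.Propositional.Properties as Unique
open import Data.Nat as ℕ using (ℕ; zero; suc; z≤n; s≤s; _<ᵇ_; _≡ᵇ_; _∸_; _!)
open import Data.Nat.DivMod using (m/n*n≤m; /-monoˡ-≤) renaming (_/_ to _div_)
import Data.Nat.Properties as ℕ
open import Data.Product using (_×_; _,_; proj₁; proj₂; ∃)
open import Data.Rational
  using (ℚ; 0ℚ; 1ℚ; _+_; _*_; _-_; -_; _/_; 1/_; _≤_; _<_; ∣_∣; ↥_; ↧ₙ_; mkℚ; toℚᵘ;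
         Positive; NonZero; positive; nonNegative)
import Data.Rational.Properties as ℚ
open import Data.Rational.Solver
open import Data.Rational.Unnormalised.Base as ℚᵘ using (mkℚᵘ; *≡*)
import Data.Rational.Unnormalised.Properties as ℚᵘ
open import Data.Sum.Base using (_⊎_; inj₁; inj₂)
open import Data.Unit.Base using (⊤; tt)
open import Data.Vec.Base using (Vec; []; _∷_; here; there; lookup; tabulate; _[_]≔_)
import Data.Vec.Properties as Vec
open import Function.Base using (_∘_; id)
open import Function.Bundles using (Equivalence)
open import Relation.Binary.Definitions using (tri<; tri≈; tri>)
open import Relation.Binary.PropositionalEquality
open import Relation.Nullary using (¬_; Dec; yes; no; contradiction)
open import Relation.Nullary.Decidable using (¬?; _⊎-dec_)

open +-*-Solver using (solve; con; _:=_; _:+_; _:*_; _:-_; :-_)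
open Algebra.Definitions.RawSemiring ℚ.+-*-rawSemiring using (_^_)

-- Sums and inequalities

≤-by-difference : ∀ {p q} s → 0ℚ ≤ s → q ≡ p + s → p ≤ q
≤-by-difference {p} {q} s 0≤s eq = subst₂ _≤_ (ℚ.+-identityʳ p) (sym eq) (ℚ.+-monoʳ-≤ p 0≤s)

0≤q-p : ∀ {p q} → p ≤ q → 0ℚ ≤ q - p
0≤q-p {p} {q} p≤q = subst (_≤ q - p) (ℚ.+-inverseʳ p) (ℚ.+-monoˡ-≤ (- p) p≤q)

0≤+ : ∀ {p q} → 0ℚ ≤ p → 0ℚ ≤ q → 0ℚ ≤ p + q
0≤+ 0≤p 0≤q = ℚ.+-mono-≤ 0≤p 0≤q

0≤* : ∀ {p q} → 0ℚ ≤ p → 0ℚ ≤ q → 0ℚ ≤ p * q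
0≤* {p} {q} 0≤p 0≤q = ℚ.nonNegative⁻¹ (p * q)
  {{ℚ.nonNeg*nonNeg⇒nonNeg p {{nonNegative 0≤p}} q {{nonNegative 0≤q}}}}

0≤1 : 0ℚ ≤ 1ℚ
0≤1 = ℚ.nonNegative⁻¹ 1ℚ

*-monoˡ : ∀ {p q} r → 0ℚ ≤ r → p ≤ q → r * p ≤ r * q
*-monoˡ r 0≤r = ℚ.*-monoˡ-≤-nonNeg r {{nonNegative 0≤r}}

*-mono : ∀ {p q r s} → 0ℚ ≤ p → 0ℚ ≤ s → p ≤ q → r ≤ s → p * r ≤ q * s
*-mono {p} {q} {r} {s} 0≤p 0≤s p≤q r≤s =
  ℚ.≤-trans (*-monoˡ p 0≤p r≤s) (ℚ.*-monoʳ-≤-nonNeg s {{nonNegative 0≤s}} p≤q)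

0≤^ : ∀ {p} n → 0ℚ ≤ p → 0ℚ ≤ p ^ n
0≤^ zero    0≤p = 0≤1
0≤^ (suc n) 0≤p = 0≤* 0≤p (0≤^ n 0≤p)

^≤1 : ∀ {p} n → 0ℚ ≤ p → p ≤ 1ℚ → p ^ n ≤ 1ℚ
^≤1 zero    0≤p p≤1 = ℚ.≤-refl
^≤1 (suc n) 0≤p p≤1 = *-mono 0≤p 0≤1 p≤1 (^≤1 n 0≤p p≤1)

^-mono : ∀ {p q} n → 0ℚ ≤ p → p ≤ q → p ^ n ≤ q ^ n
^-mono zero    0≤p p≤q = ℚ.≤-refl
^-mono (suc n) 0≤p p≤q = *-mono 0≤p (0≤^ n (ℚ.≤-trans 0≤p p≤q)) p≤q (^-mono n 0≤p p≤q)

^-distrib-* : ∀ p q n → (p * q) ^ n ≡ p ^ n * q ^ n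
^-distrib-* p q zero    = refl
^-distrib-* p q (suc n) = trans (cong (p * q *_) (^-distrib-* p q n))
  (solve 4 (λ a b c d → a :* b :* (c :* d) := a :* c :* (b :* d)) refl p q (p ^ n) (q ^ n))

-- Defined by recursion so that inductions over `ι (suc n)` reduce to ring identities; `/-*-ι` later
-- connects it with fractions.
ι : ℕ → ℚ
ι zero    = 0ℚ
ι (suc n) = ι n + 1ℚ

0≤ι : ∀ n → 0ℚ ≤ ι n
0≤ι zero    = ℚ.≤-refl
0≤ι (suc n) = 0≤+ (0≤ι n) 0≤1

ι-mono : ∀ {m n} → m ℕ.≤ n → ι m ≤ ι n
ι-mono {n = n} z≤n = 0≤ι n
ι-mono (s≤s m≤n)   = ℚ.+-monoˡ-≤ 1ℚ (ι-mono m≤n)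

ι-+ : ∀ m n → ι (m ℕ.+ n) ≡ ι m + ι n
ι-+ zero    n = sym (ℚ.+-identityˡ (ι n))
ι-+ (suc m) n = trans (cong (_+ 1ℚ) (ι-+ m n))
  (solve 2 (λ a b → a :+ b :+ con 1ℚ := a :+ con 1ℚ :+ b) refl (ι m) (ι n))

ι-* : ∀ m n → ι (m ℕ.* n) ≡ ι m * ι n
ι-* zero    n = sym (ℚ.*-zeroˡ (ι n))
ι-* (suc m) n = trans (ι-+ n (m ℕ.* n)) (trans (cong (λ s → ι n + s) (ι-* m n))
  (solve 2 (λ a b → b :+ a :* b := (a :+ con 1ℚ) :* b) refl (ι m) (ι n)))

ι-^ : ∀ m n → ι (m ℕ.^ n) ≡ ι m ^ n
ι-^ m zero    = refl
ι-^ m (suc n) = trans (ι-* m (m ℕ.^ n)) (cong (ι m *_) (ι-^ m n))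

∑ : ℕ → (ℕ → ℚ) → ℚ
∑ zero    f = 0ℚ
∑ (suc n) f = ∑ n f + f n

∑-cong : ∀ n {f g} → (∀ x → x ℕ.< n → f x ≡ g x) → ∑ n f ≡ ∑ n g
∑-cong zero    f≡g = refl
∑-cong (suc n) f≡g = cong₂ _+_ (∑-cong n λ x x<n → f≡g x (ℕ.m<n⇒m<1+n x<n)) (f≡g n ℕ.≤-refl)

∑-mono : ∀ n {f g} → (∀ x → x ℕ.< n → f x ≤ g x) → ∑ n f ≤ ∑ n g
∑-mono zero    f≤g = ℚ.≤-refl
∑-mono (suc n) f≤g =
  ℚ.+-mono-≤ (∑-mono n λ x x<n → f≤g x (ℕ.m<n⇒m<1+n x<n)) (f≤g n ℕ.≤-refl)

∑-const : ∀ n c → ∑ n (λ _ → c) ≡ ι n * c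
∑-const zero    c = sym (ℚ.*-zeroˡ c)
∑-const (suc n) c = trans (cong (_+ c) (∑-const n c))
  (solve 2 (λ a c → a :* c :+ c := (a :+ con 1ℚ) :* c) refl (ι n) c)

∑-*ˡ : ∀ n c f → ∑ n (λ x → c * f x) ≡ c * ∑ n f
∑-*ˡ zero    c f = sym (ℚ.*-zeroʳ c)
∑-*ˡ (suc n) c f = trans (cong (_+ c * f n) (∑-*ˡ n c f)) (sym (ℚ.*-distribˡ-+ c (∑ n f) (f n)))

∑-+ : ∀ n f g → ∑ n (λ x → f x + g x) ≡ ∑ n f + ∑ n g
∑-+ zero    f g = refl
∑-+ (suc n) f g = trans (cong (_+ (f n + g n)) (∑-+ n f g))
  (solve 4 (λ a b c d → a :+ b :+ (c :+ d) := a :+ c :+ (b :+ d)) refl (∑ n f) (∑ n g) (f n) (g n))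

∑-abs : ∀ n {f g h} → (∀ x → x ℕ.< n → ∣ f x - g x ∣ ≤ h x) → ∣ ∑ n f - ∑ n g ∣ ≤ ∑ n h
∑-abs zero    bd = ℚ.≤-refl
∑-abs (suc n) {f} {g} {h} bd = ℚ.≤-trans
  (subst (λ q → ∣ q ∣ ≤ ∣ ∑ n f - ∑ n g ∣ + ∣ f n - g n ∣)
    (solve 4 (λ a b c d → a :- b :+ (c :- d) := a :+ c :- (b :+ d)) refl (∑ n f) (∑ n g) (f n) (g n))
    (ℚ.∣p+q∣≤∣p∣+∣q∣ (∑ n f - ∑ n g) (f n - g n)))
  (ℚ.+-mono-≤ (∑-abs n λ x x<n → bd x (ℕ.m<n⇒m<1+n x<n)) (bd n ℕ.≤-refl))

p≤∣p∣ : ∀ p → p ≤ ∣ p ∣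
p≤∣p∣ p with ℚ.≤-total 0ℚ p
... | inj₁ 0≤p = ℚ.≤-reflexive (sym (ℚ.0≤p⇒∣p∣≡p 0≤p))
... | inj₂ p≤0 = ℚ.≤-trans p≤0 (ℚ.0≤∣p∣ p)

-- Telescoping: p pⁿ - q qⁿ = p (pⁿ - qⁿ) + qⁿ (p - q), and the factors p and qⁿ lie in [0, 1].
^-abs : ∀ {p q} n → 0ℚ ≤ p → p ≤ 1ℚ → 0ℚ ≤ q → q ≤ 1ℚ → ∣ p ^ n - q ^ n ∣ ≤ ι n * ∣ p - q ∣
^-abs {p} {q} zero _ _ _ _ = ℚ.≤-reflexive (sym (ℚ.*-zeroˡ ∣ p - q ∣))
^-abs {p} {q} (suc n) 0≤p p≤1 0≤q q≤1 = begin
  ∣ p * p ^ n - q * q ^ n ∣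
    ≡⟨ cong ∣_∣ (solve 4 (λ p q a b → p :* a :- q :* b := p :* (a :- b) :+ b :* (p :- q)) refl
         p q (p ^ n) (q ^ n)) ⟩
  ∣ p * (p ^ n - q ^ n) + q ^ n * (p - q) ∣
    ≤⟨ ℚ.∣p+q∣≤∣p∣+∣q∣ (p * (p ^ n - q ^ n)) (q ^ n * (p - q)) ⟩
  ∣ p * (p ^ n - q ^ n) ∣ + ∣ q ^ n * (p - q) ∣
    ≤⟨ ℚ.+-mono-≤ (shrink (p ^ n - q ^ n) 0≤p p≤1) (shrink (p - q) (0≤^ n 0≤q) (^≤1 n 0≤q q≤1)) ⟩
  ∣ p ^ n - q ^ n ∣ + ∣ p - q ∣
    ≤⟨ ℚ.+-monoˡ-≤ ∣ p - q ∣ (^-abs n 0≤p p≤1 0≤q q≤1) ⟩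
  ι n * ∣ p - q ∣ + ∣ p - q ∣
    ≡⟨ solve 2 (λ a d → a :* d :+ d := (a :+ con 1ℚ) :* d) refl (ι n) ∣ p - q ∣ ⟩
  (ι n + 1ℚ) * ∣ p - q ∣ ∎
  where
  open ℚ.≤-Reasoning
  shrink : ∀ {c} x → 0ℚ ≤ c → c ≤ 1ℚ → ∣ c * x ∣ ≤ ∣ x ∣
  shrink {c} x 0≤c c≤1 = subst₂ _≤_
    (trans (cong (_* ∣ x ∣) (sym (ℚ.0≤p⇒∣p∣≡p 0≤c))) (sym (ℚ.∣p*q∣≡∣p∣*∣q∣ c x)))
    (ℚ.*-identityˡ ∣ x ∣)
    (*-mono 0≤c (ℚ.0≤∣p∣ x) c≤1 ℚ.≤-refl)

-- These are the leading terms of the binomial expansion; the induction step discards only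
-- `ι (suc n) * (b * b * a ^ n)`.
bernoulli : ∀ {a b} n → 0ℚ ≤ a → 0ℚ ≤ b → a ^ suc n + ι (suc n) * (b * a ^ n) ≤ (a + b) ^ suc n
bernoulli {a} {b} zero 0≤a 0≤b = ℚ.≤-reflexive
  (solve 2 (λ a b → a :* con 1ℚ :+ (con 0ℚ :+ con 1ℚ) :* (b :* con 1ℚ) := (a :+ b) :* con 1ℚ) refl a b)
bernoulli {a} {b} (suc n) 0≤a 0≤b = ℚ.≤-trans
  (≤-by-difference (ι (suc n) * (b * b * a ^ n))
    (0≤* (0≤ι (suc n)) (0≤* (0≤* 0≤b 0≤b) (0≤^ n 0≤a)))
    (solve 4 (λ a b s p → (a :+ b) :* (a :* p :+ s :* (b :* p))
      := a :* (a :* p) :+ (s :+ con 1ℚ) :* (b :* (a :* p)) :+ s :* (b :* b :* p)) refl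
      a b (ι (suc n)) (a ^ n)))
  (*-monoˡ (a + b) (0≤+ 0≤a 0≤b) (bernoulli n 0≤a 0≤b))

-- A division-free form of (1 - a)ⁿ ≤ 1 / (1 + n a). The induction rests on (1 - a)(1 + (n + 1) a) =
-- 1 + n a - (n + 1) a².
bernoulli⁻ : ∀ {a} n → 0ℚ ≤ a → a ≤ 1ℚ → (1ℚ - a) ^ n * (1ℚ + ι n * a) ≤ 1ℚ
bernoulli⁻ {a} zero _ _ = ℚ.≤-reflexive
  (solve 1 (λ a → con 1ℚ :* (con 1ℚ :+ con 0ℚ :* a) := con 1ℚ) refl a)
bernoulli⁻ {a} (suc n) 0≤a a≤1 = ℚ.≤-trans
  (≤-by-difference ((1ℚ - a) ^ n * (ι (suc n) * (a * a)))
    (0≤* (0≤^ n (0≤q-p a≤1)) (0≤* (0≤ι (suc n)) (0≤* 0≤a 0≤a)))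
    (solve 3 (λ a s p → p :* (con 1ℚ :+ s :* a)
      := (con 1ℚ :- a) :* p :* (con 1ℚ :+ (s :+ con 1ℚ) :* a) :+ p :* ((s :+ con 1ℚ) :* (a :* a))) refl
      a (ι n) ((1ℚ - a) ^ n)))
  (bernoulli⁻ n 0≤a a≤1)

-- The recursion on a regular tree

⟦_⟧ : Bool → ℚ
⟦ b ⟧ = if b then 1ℚ else 0ℚ

0≤⟦⟧ : ∀ b → 0ℚ ≤ ⟦ b ⟧
0≤⟦⟧ true  = 0≤1
0≤⟦⟧ false = ℚ.≤-refl

⟦⟧≤1 : ∀ b → ⟦ b ⟧ ≤ 1ℚ
⟦⟧≤1 true  = ℚ.≤-refl
⟦⟧≤1 false = 0≤1

-- The sum analogue of integrating y^j: `bernoulli` with b = 1 bounds each increment of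
-- `ι x ^ suc j` from below.
power-sum : ∀ j x → ι (suc j) * ∑ x (λ y → ι y ^ j) ≤ ι x ^ suc j
power-sum j zero    = ℚ.≤-reflexive (trans (ℚ.*-zeroʳ (ι (suc j))) (sym (ℚ.*-zeroˡ (0ℚ ^ j))))
power-sum j (suc x) = begin
  ι (suc j) * (∑ x (λ y → ι y ^ j) + ι x ^ j)
    ≡⟨ solve 3 (λ a b c → a :* (b :+ c) := a :* b :+ a :* (con 1ℚ :* c)) refl
         (ι (suc j)) (∑ x (λ y → ι y ^ j)) (ι x ^ j) ⟩
  ι (suc j) * ∑ x (λ y → ι y ^ j) + ι (suc j) * (1ℚ * ι x ^ j)
    ≤⟨ ℚ.+-monoˡ-≤ _ (power-sum j x) ⟩
  ι x ^ suc j + ι (suc j) * (1ℚ * ι x ^ j)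
    ≤⟨ bernoulli j (0≤ι x) 0≤1 ⟩
  ι (suc x) ^ suc j ∎
  where open ℚ.≤-Reasoning

1^ : ∀ n → 1ℚ ^ n ≡ 1ℚ
1^ zero    = refl
1^ (suc n) = trans (ℚ.*-identityˡ (1ℚ ^ n)) (1^ n)

module Recursion (ε : ℚ) (0≤ε : 0ℚ ≤ ε) (N : ℕ) (0<N : 0 ℕ.< N) (εN≡1 : ε * ι N ≡ 1ℚ) where

  -- If h y is the probability that a child of weight y is chosen, then Φ h x is the
  -- probability that a given child does not block a node of weight x.
  Φ : (ℕ → ℚ) → ℕ → ℚ
  Φ h x = 1ℚ - ε - ε * ∑ x h

  -- Iterated sums of the constant 1, the discrete counterpart of s^j / j! at s = ε x. They carry
  -- the truncation error from level to level.
  W : ℕ → ℕ → ℚ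
  W zero    x = 1ℚ
  W (suc j) x = ε * ∑ x (W j)

  -- By `power-sum`, the summation at level j + 1 gains a factor 1 / (j + 1); this is the origin of
  -- the factorial.
  W-bound : ∀ j x → W j x * ι (j !) ≤ (ε * ι x) ^ j
  W-bound zero    x = ℚ.≤-refl
  W-bound (suc j) x = begin
    ε * ∑ x (W j) * ι (suc j ℕ.* j !)
      ≡⟨ cong (ε * ∑ x (W j) *_) (ι-* (suc j) (j !)) ⟩
    ε * ∑ x (W j) * (ι (suc j) * ι (j !))
      ≡⟨ solve 4 (λ e w s f → e :* w :* (s :* f) := e :* s :* (f :* w)) refl
           ε (∑ x (W j)) (ι (suc j)) (ι (j !)) ⟩
    ε * ι (suc j) * (ι (j !) * ∑ x (W j))
      ≡⟨ cong (ε * ι (suc j) *_) (sym (∑-*ˡ x (ι (j !)) (W j))) ⟩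
    ε * ι (suc j) * ∑ x (λ y → ι (j !) * W j y)
      ≤⟨ *-monoˡ _ (0≤* 0≤ε (0≤ι (suc j))) (∑-mono x λ y _ →
           subst₂ _≤_ (ℚ.*-comm (W j y) (ι (j !))) (^-distrib-* ε (ι y) j) (W-bound j y)) ⟩
    ε * ι (suc j) * ∑ x (λ y → ε ^ j * ι y ^ j)
      ≡⟨ cong (ε * ι (suc j) *_) (∑-*ˡ x (ε ^ j) (λ y → ι y ^ j)) ⟩
    ε * ι (suc j) * (ε ^ j * ∑ x (λ y → ι y ^ j))
      ≡⟨ solve 4 (λ e s p q → e :* s :* (p :* q) := e :* p :* (s :* q)) refl
           ε (ι (suc j)) (ε ^ j) (∑ x (λ y → ι y ^ j)) ⟩
    ε ^ suc j * (ι (suc j) * ∑ x (λ y → ι y ^ j))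
      ≤⟨ *-monoˡ _ (0≤^ (suc j) 0≤ε) (power-sum j x) ⟩
    ε ^ suc j * ι x ^ suc j
      ≡⟨ sym (^-distrib-* ε (ι x) (suc j)) ⟩
    (ε * ι x) ^ suc j ∎
    where open ℚ.≤-Reasoning

  W-N : ∀ j → W j N * ι (j !) ≤ 1ℚ
  W-N j = subst (W j N * ι (j !) ≤_) (trans (cong (_^ j) εN≡1) (1^ j)) (W-bound j N)

  0≤W : ∀ j x → 0ℚ ≤ W j x
  0≤W zero    x = 0≤1
  0≤W (suc j) x = 0≤* 0≤ε (subst (_≤ ∑ x (W j)) (trans (∑-const x 0ℚ) (ℚ.*-zeroʳ (ι x)))
    (∑-mono x λ y _ → 0≤W j y))

  ε*suc≤1 : ∀ x → x ℕ.< N → ε * ι (suc x) ≤ 1ℚ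
  ε*suc≤1 x x<N = subst (ε * ι (suc x) ≤_) εN≡1 (*-monoˡ ε 0≤ε (ι-mono x<N))

  -- The worst case is h = 1, where `Φ` has the value 1 - ε (x + 1).
  0≤Φ : ∀ {h} x → x ℕ.< N → (∀ y → y ℕ.< N → h y ≤ 1ℚ) → 0ℚ ≤ Φ h x
  0≤Φ {h} x x<N h≤1 = ℚ.≤-trans (0≤q-p (ε*suc≤1 x x<N))
    (≤-by-difference (ε * (ι x * 1ℚ - ∑ x h))
      (0≤* 0≤ε (0≤q-p (subst (∑ x h ≤_) (∑-const x 1ℚ)
        (∑-mono x λ y y<x → h≤1 y (ℕ.<-trans y<x x<N)))))
      (solve 3 (λ e i s → con 1ℚ :- e :- e :* s
        := con 1ℚ :- e :* (i :+ con 1ℚ) :+ e :* (i :* con 1ℚ :- s)) refl ε (ι x) (∑ x h)))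

  Φ≤1 : ∀ {h} x → x ℕ.< N → (∀ y → y ℕ.< N → 0ℚ ≤ h y) → Φ h x ≤ 1ℚ
  Φ≤1 {h} x x<N 0≤h = ≤-by-difference (ε + ε * (∑ x h - ι x * 0ℚ))
    (0≤+ 0≤ε (0≤* 0≤ε (0≤q-p (subst (_≤ ∑ x h) (∑-const x 0ℚ)
      (∑-mono x λ y y<x → 0≤h y (ℕ.<-trans y<x x<N))))))
    (solve 3 (λ e i s → con 1ℚ := con 1ℚ :- e :- e :* s :+ (e :+ e :* (s :- i :* con 0ℚ))) refl
      ε (ι x) (∑ x h))

  Φ-abs : ∀ {f g h} x → (∀ y → y ℕ.< x → ∣ f y - g y ∣ ≤ h y) → ∣ Φ f x - Φ g x ∣ ≤ ε * ∑ x h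
  Φ-abs {f} {g} {h} x bd = begin
    ∣ Φ f x - Φ g x ∣
      ≡⟨ cong ∣_∣ (solve 3 (λ e a b → con 1ℚ :- e :- e :* a :- (con 1ℚ :- e :- e :* b)
           := :- (e :* (a :- b))) refl ε (∑ x f) (∑ x g)) ⟩
    ∣ - (ε * (∑ x f - ∑ x g)) ∣  ≡⟨ ℚ.∣-p∣≡∣p∣ (ε * (∑ x f - ∑ x g)) ⟩
    ∣ ε * (∑ x f - ∑ x g) ∣      ≡⟨ ℚ.∣p*q∣≡∣p∣*∣q∣ ε (∑ x f - ∑ x g) ⟩
    ∣ ε ∣ * ∣ ∑ x f - ∑ x g ∣    ≡⟨ cong (_* ∣ ∑ x f - ∑ x g ∣) (ℚ.0≤p⇒∣p∣≡p 0≤ε) ⟩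
    ε * ∣ ∑ x f - ∑ x g ∣        ≤⟨ *-monoˡ ε 0≤ε (∑-abs x bd) ⟩
    ε * ∑ x h                    ∎
    where open ℚ.≤-Reasoning

  ε≤1 : ε ≤ 1ℚ
  ε≤1 = subst (_≤ 1ℚ) (ℚ.*-identityʳ ε) (ε*suc≤1 0 0<N)

  module _ (m : ℕ) where

    -- The Euler scheme for r = 2 + m. It starts at 1 - ε, the value of `Φ` at weight 0, where ties
    -- alone cause the loss.
    z : ℕ → ℚ
    z zero    = 1ℚ - ε
    z (suc x) = z x - ε * z x ^ suc m

    -- So `λ y → z y ^ suc m` is a fixed point of the recursion defining `t`: it plays the role of
    -- the choice probability on the infinite tree, where a node other than the root has `suc m`
    -- children.
    z≡Φ : ∀ x → z x ≡ Φ (λ y → z y ^ suc m) x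
    z≡Φ zero    = solve 1 (λ e → con 1ℚ :- e := con 1ℚ :- e :- e :* con 0ℚ) refl ε
    z≡Φ (suc x) = trans (cong (_- ε * z x ^ suc m) (z≡Φ x))
      (solve 3 (λ e s p → con 1ℚ :- e :- e :* s :- e :* p := con 1ℚ :- e :- e :* (s :+ p)) refl
        ε (∑ x (λ y → z y ^ suc m)) (z x ^ suc m))

    z-range : ∀ x → 0ℚ ≤ z x × z x ≤ 1ℚ
    z-range zero    = 0≤q-p ε≤1 ,
      ≤-by-difference ε 0≤ε (solve 1 (λ e → con 1ℚ := con 1ℚ :- e :+ e) refl ε)
    z-range (suc x) with 0≤z , z≤1 ← z-range x =
      subst (0ℚ ≤_)
        (solve 3 (λ e z p → z :* (con 1ℚ :- e :* p) := z :- e :* (z :* p)) refl ε (z x) (z x ^ m))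
        (0≤* 0≤z (0≤q-p (*-mono 0≤ε 0≤1 ε≤1 (^≤1 m 0≤z z≤1)))) ,
      ℚ.≤-trans
        (≤-by-difference (ε * z x ^ suc m) (0≤* 0≤ε (0≤^ (suc m) 0≤z))
          (solve 2 (λ z s → z := z :- s :+ s) refl (z x) (ε * z x ^ suc m)))
        z≤1

    -- The discrete form of (z⁻ᵐ)′ ≥ m.
    z-decay : ∀ x → z x ^ m * (1ℚ + ι m * (ε * ι x)) ≤ 1ℚ
    z-decay zero    = subst (_≤ 1ℚ)
      (solve 3 (λ p i e → p := p :* (con 1ℚ :+ i :* (e :* con 0ℚ))) refl (z 0 ^ m) (ι m) ε)
      (^≤1 m (proj₁ (z-range 0)) (proj₂ (z-range 0)))
    z-decay (suc x) = begin
      (z x - ε * z x ^ suc m) ^ m * (1ℚ + ι m * (ε * (ι x + 1ℚ)))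
        ≡⟨ cong (λ p → p ^ m * (1ℚ + ι m * (ε * (ι x + 1ℚ))))
             (solve 3 (λ e z s → z :- e :* (z :* s) := z :* (con 1ℚ :- e :* s)) refl ε (z x) s) ⟩
      (z x * (1ℚ - ε * s)) ^ m * (1ℚ + ι m * (ε * (ι x + 1ℚ)))
        ≡⟨ cong (_* (1ℚ + ι m * (ε * (ι x + 1ℚ)))) (^-distrib-* (z x) (1ℚ - ε * s) m) ⟩
      s * b * (1ℚ + ι m * (ε * (ι x + 1ℚ)))
        ≡⟨ solve 5 (λ s b m e x → s :* b :* (con 1ℚ :+ m :* (e :* (x :+ con 1ℚ)))
             := b :* (s :* (con 1ℚ :+ m :* (e :* x)) :+ m :* (e :* s))) refl s b (ι m) ε (ι x) ⟩
      b * (s * (1ℚ + ι m * (ε * ι x)) + ι m * (ε * s))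
        -- The induction hypothesis leaves 1 + m (ε s), which `bernoulli⁻` at a = ε s absorbs.
        ≤⟨ *-monoˡ b (0≤^ m (0≤q-p εs≤1)) (ℚ.+-monoˡ-≤ (ι m * (ε * s)) (z-decay x)) ⟩
      b * (1ℚ + ι m * (ε * s))
        ≤⟨ bernoulli⁻ m (0≤* 0≤ε 0≤s) εs≤1 ⟩
      1ℚ ∎
      where
      open ℚ.≤-Reasoning
      s = z x ^ m
      b = (1ℚ - ε * s) ^ m
      0≤s : 0ℚ ≤ s
      0≤s = 0≤^ m (proj₁ (z-range x))
      εs≤1 : ε * s ≤ 1ℚ
      εs≤1 = *-mono 0≤ε 0≤1 ε≤1 (^≤1 m (proj₁ (z-range x)) (proj₂ (z-range x)))

    -- At x = N the elapsed time ε x is 1, so the bracket in `z-decay` becomes 1 + m = r - 1.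
    z-N : z N ^ m * ι (suc m) ≤ 1ℚ
    z-N = subst (λ p → z N ^ m * p ≤ 1ℚ)
      (trans (cong (λ p → 1ℚ + ι m * p) εN≡1)
        (solve 1 (λ i → con 1ℚ :+ i :* con 1ℚ := i :+ con 1ℚ) refl (ι m)))
      (z-decay N)

    -- The discrete form of (z²)′ ≥ -2zʳ.
    z²-drop : ∀ x → z 0 * z 0 ≤ z x * z x + (1ℚ + 1ℚ) * (ε * ∑ x (λ y → z y ^ (2 ℕ.+ m)))
    z²-drop zero    = ℚ.≤-reflexive
      (solve 2 (λ a e → a := a :+ (con 1ℚ :+ con 1ℚ) :* (e :* con 0ℚ)) refl (z 0 * z 0) ε)
    z²-drop (suc x) = ℚ.≤-trans (z²-drop x)
      -- The second-order term of the Euler step is a square, so it has the favourable sign.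
      (≤-by-difference (ε * z x ^ suc m * (ε * z x ^ suc m)) (0≤* 0≤t 0≤t)
        (solve 4 (λ e z p s →
          (z :- e :* p) :* (z :- e :* p) :+ (con 1ℚ :+ con 1ℚ) :* (e :* (s :+ z :* p))
          := z :* z :+ (con 1ℚ :+ con 1ℚ) :* (e :* s) :+ e :* p :* (e :* p)) refl
          ε (z x) (z x ^ suc m) (∑ x (λ y → z y ^ (2 ℕ.+ m)))))
      where
      0≤t : 0ℚ ≤ ε * z x ^ suc m
      0≤t = 0≤* 0≤ε (0≤^ (suc m) (proj₁ (z-range x)))

    -- The probability that a node of weight x is chosen on a tree of depth j.
    t : Bool → ℕ → ℕ → ℚ
    t b zero    x = ⟦ b ⟧
    t b (suc j) x = Φ (t (not b) j) x ^ suc m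

    t-range : ∀ b j x → x ℕ.< N → 0ℚ ≤ t b j x × t b j x ≤ 1ℚ
    t-range b zero    x x<N = 0≤⟦⟧ b , ⟦⟧≤1 b
    t-range b (suc j) x x<N = 0≤^ (suc m) 0≤g , ^≤1 (suc m) 0≤g g≤1
      where
      0≤g = 0≤Φ x x<N λ y y<N → proj₂ (t-range (not b) j y y<N)
      g≤1 = Φ≤1 x x<N λ y y<N → proj₁ (t-range (not b) j y y<N)

    0≤Φ-t : ∀ b j x → x ℕ.< N → 0ℚ ≤ Φ (t b j) x
    0≤Φ-t b j x x<N = 0≤Φ x x<N λ y y<N → proj₂ (t-range b j y y<N)

    Φ-t≤1 : ∀ b j x → x ℕ.< N → Φ (t b j) x ≤ 1ℚ
    Φ-t≤1 b j x x<N = Φ≤1 x x<N λ y y<N → proj₁ (t-range b j y y<N)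

    -- The two bounds alternate. Applying `Φ` sums the error once more and raises the index of `W`;
    -- taking the power costs the Lipschitz constant `suc m`. At depth 0 the error is at most 1, as
    -- both values lie in [0, 1].
    Φ-t-abs : ∀ b j x → x ℕ.< N → ∣ Φ (t b j) x - z x ∣ ≤ ι (suc m) ^ j * W (suc j) x
    t-abs   : ∀ b j x → x ℕ.< N → ∣ t b j x - z x ^ suc m ∣ ≤ ι (suc m) ^ j * W j x

    Φ-t-abs b j x x<N = subst₂ (λ p q → ∣ Φ (t b j) x - p ∣ ≤ q) (sym (z≡Φ x))
      (trans (cong (ε *_) (∑-*ˡ x (ι (suc m) ^ j) (W j)))
        (solve 3 (λ e d w → e :* (d :* w) := d :* (e :* w)) refl ε (ι (suc m) ^ j) (∑ x (W j))))
      (Φ-abs x λ y y<x → t-abs b j y (ℕ.<-trans y<x x<N))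

    t-abs b zero x x<N with 0≤z , z≤1 ← z-range x = distance b
      where
      0≤p = 0≤^ (suc m) 0≤z
      p≤1 = ^≤1 (suc m) 0≤z z≤1
      distance : ∀ b → ∣ ⟦ b ⟧ - z x ^ suc m ∣ ≤ 1ℚ * 1ℚ
      distance true  = subst (_≤ 1ℚ * 1ℚ) (sym (ℚ.0≤p⇒∣p∣≡p (0≤q-p p≤1)))
        (≤-by-difference (z x ^ suc m) 0≤p
          (solve 1 (λ p → con 1ℚ :* con 1ℚ := con 1ℚ :- p :+ p) refl (z x ^ suc m)))
      distance false = subst (_≤ 1ℚ * 1ℚ)
        (sym (trans (cong ∣_∣ (ℚ.+-identityˡ (- z x ^ suc m)))
          (trans (ℚ.∣-p∣≡∣p∣ (z x ^ suc m)) (ℚ.0≤p⇒∣p∣≡p 0≤p)))) p≤1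
    t-abs b (suc j) x x<N with 0≤z , z≤1 ← z-range x = begin
      ∣ Φ (t (not b) j) x ^ suc m - z x ^ suc m ∣
        ≤⟨ ^-abs (suc m) (0≤Φ-t (not b) j x x<N) (Φ-t≤1 (not b) j x x<N) 0≤z z≤1 ⟩
      ι (suc m) * ∣ Φ (t (not b) j) x - z x ∣
        ≤⟨ *-monoˡ _ (0≤ι (suc m)) (Φ-t-abs (not b) j x x<N) ⟩
      ι (suc m) * (ι (suc m) ^ j * W (suc j) x)
        ≡⟨ sym (ℚ.*-assoc (ι (suc m)) (ι (suc m) ^ j) (W (suc j) x)) ⟩
      ι (suc m) ^ suc j * W (suc j) x ∎
      where open ℚ.≤-Reasoning

    -- The choice probability of a root, averaged over its weight: a root has 2 + m children, and
    -- `b` is the flag of the children.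
    root-sum : Bool → ℕ → ℚ
    root-sum b j = ε * ∑ N (λ x → Φ (t b j) x ^ (2 ℕ.+ m))

    -- The power at the root contributes the Lipschitz constant 2 + m, and averaging over the weight
    -- of the root is the last summation in `W (2 + j)`.
    z-sum≤ : ∀ b j → ε * ∑ N (λ x → z x ^ (2 ℕ.+ m))
                     ≤ root-sum b j + ι (2 ℕ.+ m) * ι (suc m) ^ j * W (2 ℕ.+ j) N
    z-sum≤ b j = begin
      ε * ∑ N (λ x → z x ^ r)
        ≤⟨ *-monoˡ ε 0≤ε (∑-mono N pointwise) ⟩
      ε * ∑ N (λ x → Φ (t b j) x ^ r + c * W (suc j) x)
        ≡⟨ cong (ε *_) (trans (∑-+ N (λ x → Φ (t b j) x ^ r) (λ x → c * W (suc j) x))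
             (cong (λ s → ∑ N (λ x → Φ (t b j) x ^ r) + s) (∑-*ˡ N c (W (suc j))))) ⟩
      ε * (∑ N (λ x → Φ (t b j) x ^ r) + c * ∑ N (W (suc j)))
        ≡⟨ solve 4 (λ e a c w → e :* (a :+ c :* w) := e :* a :+ c :* (e :* w)) refl
             ε (∑ N (λ x → Φ (t b j) x ^ r)) c (∑ N (W (suc j))) ⟩
      root-sum b j + c * W (2 ℕ.+ j) N ∎
      where
      open ℚ.≤-Reasoning
      r = 2 ℕ.+ m
      c = ι r * ι (suc m) ^ j
      pointwise : ∀ x → x ℕ.< N → z x ^ r ≤ Φ (t b j) x ^ r + c * W (suc j) x
      pointwise x x<N with 0≤z , z≤1 ← z-range x = begin
        z x ^ r
          ≡⟨ solve 2 (λ a b → a := b :+ :- (b :- a)) refl (z x ^ r) (Φ (t b j) x ^ r) ⟩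
        Φ (t b j) x ^ r + - (Φ (t b j) x ^ r - z x ^ r)
          ≤⟨ ℚ.+-monoʳ-≤ (Φ (t b j) x ^ r) (ℚ.≤-trans (p≤∣p∣ _) (ℚ.≤-reflexive (ℚ.∣-p∣≡∣p∣ _))) ⟩
        Φ (t b j) x ^ r + ∣ Φ (t b j) x ^ r - z x ^ r ∣
          ≤⟨ ℚ.+-monoʳ-≤ (Φ (t b j) x ^ r) (ℚ.≤-trans
               (^-abs r (0≤Φ-t b j x x<N) (Φ-t≤1 b j x x<N) 0≤z z≤1)
               (*-monoˡ _ (0≤ι r) (Φ-t-abs b j x x<N))) ⟩
        Φ (t b j) x ^ r + ι r * (ι (suc m) ^ j * W (suc j) x)
          ≡⟨ cong (λ s → Φ (t b j) x ^ r + s) (sym (ℚ.*-assoc (ι r) (ι (suc m) ^ j) (W (suc j) x))) ⟩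
        Φ (t b j) x ^ r + c * W (suc j) x ∎

    -- This is `z²-drop` at N with the infinite tree replaced by the truncated one; the extra ε
    -- compensates for the start at 1 - ε.
    root-sum-bound : ∀ b j → 1ℚ ≤ z N * z N + (1ℚ + 1ℚ) *
      (ε + root-sum b j + ι (2 ℕ.+ m) * ι (suc m) ^ j * W (2 ℕ.+ j) N)
    root-sum-bound b j = begin
      1ℚ
        -- Here z 0 = 1 - ε, and (1 - ε)² + 2 ε = 1 + ε².
        ≤⟨ ≤-by-difference (ε * ε) (0≤* 0≤ε 0≤ε)
             (solve 1 (λ e → (con 1ℚ :- e) :* (con 1ℚ :- e) :+ (con 1ℚ :+ con 1ℚ) :* e
               := con 1ℚ :+ e :* e) refl ε) ⟩
      z 0 * z 0 + (1ℚ + 1ℚ) * ε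
        ≤⟨ ℚ.+-monoˡ-≤ ((1ℚ + 1ℚ) * ε) (z²-drop N) ⟩
      z N * z N + (1ℚ + 1ℚ) * (ε * ∑ N (λ y → z y ^ (2 ℕ.+ m))) + (1ℚ + 1ℚ) * ε
        ≡⟨ solve 3 (λ a e s → a :+ (con 1ℚ :+ con 1ℚ) :* s :+ (con 1ℚ :+ con 1ℚ) :* e
             := a :+ (con 1ℚ :+ con 1ℚ) :* (e :+ s)) refl
             (z N * z N) ε (ε * ∑ N (λ y → z y ^ (2 ℕ.+ m))) ⟩
      z N * z N + (1ℚ + 1ℚ) * (ε + ε * ∑ N (λ y → z y ^ (2 ℕ.+ m)))
        ≤⟨ ℚ.+-monoʳ-≤ (z N * z N) (*-monoˡ (1ℚ + 1ℚ) (0≤+ 0≤1 0≤1)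
             (subst (ε + ε * ∑ N (λ y → z y ^ (2 ℕ.+ m)) ≤_)
               (sym (ℚ.+-assoc ε (root-sum b j) _)) (ℚ.+-monoʳ-≤ ε (z-sum≤ b j)))) ⟩
      z N * z N + (1ℚ + 1ℚ) *
        (ε + root-sum b j + ι (2 ℕ.+ m) * ι (suc m) ^ j * W (2 ℕ.+ j) N) ∎
      where open ℚ.≤-Reasoning

-- Independent uniform weights

⟦∧⟧ : ∀ a b → ⟦ a ∧ b ⟧ ≡ ⟦ a ⟧ * ⟦ b ⟧
⟦∧⟧ true  b = sym (ℚ.*-identityˡ ⟦ b ⟧)
⟦∧⟧ false b = sym (ℚ.*-zeroˡ ⟦ b ⟧)

∏ : {A : Set} → List A → (A → ℚ) → ℚ
∏ []       f = 1ℚ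
∏ (u ∷ us) f = f u * ∏ us f

⟦all⟧ : ∀ {A : Set} (P : A → Bool) us → ⟦ all P us ⟧ ≡ ∏ us (λ u → ⟦ P u ⟧)
⟦all⟧ P []       = refl
⟦all⟧ P (u ∷ us) = trans (⟦∧⟧ (P u) (all P us)) (cong (⟦ P u ⟧ *_) (⟦all⟧ P us))

∏-const : ∀ {A : Set} {us : List A} {f a} → All (λ u → f u ≡ a) us → ∏ us f ≡ a ^ length us
∏-const []         = refl
∏-const (eq ∷ eqs) = cong₂ _*_ eq (∏-const eqs)

≡ᵇ-comm : ∀ x y → (x ≡ᵇ y) ≡ (y ≡ᵇ x)
≡ᵇ-comm zero    zero    = refl
≡ᵇ-comm zero    (suc y) = refl
≡ᵇ-comm (suc x) zero    = refl
≡ᵇ-comm (suc x) (suc y) = ≡ᵇ-comm x y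

<ᵇ-suc : ∀ y n → ⟦ y <ᵇ n ⟧ + ⟦ y ≡ᵇ n ⟧ ≡ ⟦ y <ᵇ suc n ⟧
<ᵇ-suc zero    zero    = refl
<ᵇ-suc zero    (suc n) = refl
<ᵇ-suc (suc y) zero    = refl
<ᵇ-suc (suc y) (suc n) = <ᵇ-suc y n

∑-indicator : ∀ n y → ∑ n (λ x → ⟦ y ≡ᵇ x ⟧) ≡ ⟦ y <ᵇ n ⟧
∑-indicator zero    y = refl
∑-indicator (suc n) y = trans (cong (_+ ⟦ y ≡ᵇ n ⟧) (∑-indicator n y)) (<ᵇ-suc y n)

<ᵇ-true : ∀ {x n} → x ℕ.< n → (x <ᵇ n) ≡ true
<ᵇ-true (s≤s z≤n)         = refl
<ᵇ-true (s≤s (s≤s x≤n)) = <ᵇ-true (s≤s x≤n)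

-- Whether a node of weight x may be chosen next to one of weight y, where b
-- tells if the latter is chosen; nodes of equal weight block each other.
compatible : ℕ → ℕ → Bool → Bool
compatible x y b = if y <ᵇ x then not b else (x <ᵇ y)

-- Exactly one of three cases occurs: the nodes are compatible, the weights tie, or the neighbour
-- comes earlier and is chosen. The last case is split by the value of y, so that its expectation is
-- the sum in `Φ`.
⟦compatible⟧ : ∀ x y b →
  ⟦ compatible x y b ⟧ + (⟦ y ≡ᵇ x ⟧ + ∑ x (λ z → ⟦ y ≡ᵇ z ⟧ * ⟦ b ⟧)) ≡ 1ℚ
⟦compatible⟧ x y b =
  trans (cong (λ s → ⟦ compatible x y b ⟧ + (⟦ y ≡ᵇ x ⟧ + s)) sum≡) (cases x y b)
  where
  sum≡ : ∑ x (λ z → ⟦ y ≡ᵇ z ⟧ * ⟦ b ⟧) ≡ ⟦ b ⟧ * ⟦ y <ᵇ x ⟧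
  sum≡ = trans (∑-cong x λ z _ → ℚ.*-comm ⟦ y ≡ᵇ z ⟧ ⟦ b ⟧)
    (trans (∑-*ˡ x ⟦ b ⟧ (λ z → ⟦ y ≡ᵇ z ⟧)) (cong (⟦ b ⟧ *_) (∑-indicator x y)))
  cases : ∀ x y b → ⟦ compatible x y b ⟧ + (⟦ y ≡ᵇ x ⟧ + ⟦ b ⟧ * ⟦ y <ᵇ x ⟧) ≡ 1ℚ
  cases zero    zero    true  = refl
  cases zero    zero    false = refl
  cases zero    (suc y) true  = refl
  cases zero    (suc y) false = refl
  cases (suc x) zero    true  = refl
  cases (suc x) zero    false = refl
  cases (suc x) (suc y) b     = cases x y b

compatible-antitone : ∀ x y {b b′} → (T b′ → T b) → T (compatible x y b) → T (compatible x y b′)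
compatible-antitone x y b′⇒b with y <ᵇ x
... | false = id
... | true  = not-antitone b′⇒b
  where
  not-antitone : ∀ {b b′} → (T b′ → T b) → T (not b) → T (not b′)
  not-antitone {false} {false} _ _ = tt
  not-antitone {false} {true}  h _ = h tt

compatible-equal : ∀ {x y} b → x ≡ y → ¬ T (compatible x y b)
compatible-equal {zero}  b refl = λ ()
compatible-equal {suc x} b refl = compatible-equal {x} b refl

compatible-lower : ∀ {x y} b → y ℕ.< x → T (compatible x y b) → ¬ T b
compatible-lower true  y<x rewrite <ᵇ-true y<x = λ ()
compatible-lower false _ _ ()

Ignores : ∀ {n} {A : Set} → (Vec ℕ n → A) → Fin n → Set
Ignores f i = ∀ w a → f (w [ i ]≔ a) ≡ f w

-- Independence in combinatorial form: no weight influences both functions.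
Independent-functions : ∀ {n} → (f g : Vec ℕ n → ℚ) → Set
Independent-functions f g = ∀ i → Ignores f i ⊎ Ignores g i

-- In this combinatorial form independence passes to products, so pairwise independence suffices for
-- `E-∏`.
∏-independent : ∀ {n} {A : Set} {f : Vec ℕ n → ℚ} {F : A → Vec ℕ n → ℚ} {us} →
  All (λ u → Independent-functions f (F u)) us →
  Independent-functions f (λ w → ∏ us (λ u → F u w))
∏-independent []           i = inj₂ λ _ _ → refl
∏-independent (ind ∷ inds) i with ind i | ∏-independent inds i
... | inj₁ p | _      = inj₁ p
... | inj₂ _ | inj₁ p = inj₁ p
... | inj₂ p | inj₂ q = inj₂ λ w a → cong₂ _*_ (p w a) (q w a)

-- Expectation over n independent weights, each uniform on {0, …, N − 1}, where ε = 1/N.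
module Expectation (ε : ℚ) (0≤ε : 0ℚ ≤ ε) (N : ℕ) (εN≡1 : ε * ι N ≡ 1ℚ) where

  E : ∀ {n} → (Vec ℕ n → ℚ) → ℚ
  E {zero}  f = f []
  E {suc n} f = ε * ∑ N (λ x → E (λ w → f (x ∷ w)))

  average-const : ∀ c → ε * ∑ N (λ _ → c) ≡ c
  average-const c = begin
    ε * ∑ N (λ _ → c)  ≡⟨ cong (ε *_) (∑-const N c) ⟩
    ε * (ι N * c)      ≡⟨ sym (ℚ.*-assoc ε (ι N) c) ⟩
    ε * ι N * c        ≡⟨ cong (_* c) εN≡1 ⟩
    1ℚ * c             ≡⟨ ℚ.*-identityˡ c ⟩
    c                  ∎
    where open ≡-Reasoning

  E-cong : ∀ {n} {f g : Vec ℕ n → ℚ} → (∀ w → f w ≡ g w) → E f ≡ E g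
  E-cong {zero}  f≡g = f≡g []
  E-cong {suc n} f≡g = cong (ε *_) (∑-cong N λ x _ → E-cong λ w → f≡g (x ∷ w))

  E-mono : ∀ {n} {f g : Vec ℕ n → ℚ} → (∀ w → f w ≤ g w) → E f ≤ E g
  E-mono {zero}  f≤g = f≤g []
  E-mono {suc n} f≤g = *-monoˡ ε 0≤ε (∑-mono N λ x _ → E-mono λ w → f≤g (x ∷ w))

  E-const : ∀ {n} c → E {n} (λ _ → c) ≡ c
  E-const {zero}  c = refl
  E-const {suc n} c = trans (cong (ε *_) (∑-cong N λ _ _ → E-const {n} c)) (average-const c)

  E-+ : ∀ {n} (f g : Vec ℕ n → ℚ) → E (λ w → f w + g w) ≡ E f + E g
  E-+ {zero}  f g = refl
  E-+ {suc n} f g = begin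
    ε * ∑ N (λ x → E (λ w → f (x ∷ w) + g (x ∷ w)))
      ≡⟨ cong (ε *_) (∑-cong N λ x _ → E-+ (λ w → f (x ∷ w)) (λ w → g (x ∷ w))) ⟩
    ε * ∑ N (λ x → E (λ w → f (x ∷ w)) + E (λ w → g (x ∷ w)))
      ≡⟨ cong (ε *_) (∑-+ N (λ x → E (λ w → f (x ∷ w))) (λ x → E (λ w → g (x ∷ w)))) ⟩
    ε * (∑ N (λ x → E (λ w → f (x ∷ w))) + ∑ N (λ x → E (λ w → g (x ∷ w))))
      ≡⟨ ℚ.*-distribˡ-+ ε (∑ N (λ x → E (λ w → f (x ∷ w)))) (∑ N (λ x → E (λ w → g (x ∷ w)))) ⟩
    E f + E g ∎
    where open ≡-Reasoning

  E-∑ : ∀ {n} k (f : ℕ → Vec ℕ n → ℚ) → E (λ w → ∑ k (λ x → f x w)) ≡ ∑ k (λ x → E (f x))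
  E-∑ {n} zero f = E-const {n} 0ℚ
  E-∑ (suc k) f = trans (E-+ (λ w → ∑ k (λ x → f x w)) (f k)) (cong (_+ E (f k)) (E-∑ k f))

  -- Induction on the number of weights: one of the two functions ignores the first weight, hence
  -- its inner expectation leaves the outer sum.
  E-independent : ∀ {n} (f g : Vec ℕ n → ℚ) → Independent-functions f g →
                  E (λ w → f w * g w) ≡ E f * E g
  E-independent {zero}  f g ind = refl
  E-independent {suc n} f g ind = trans (cong (ε *_) (∑-cong N λ x _ →
      E-independent (λ w → f (x ∷ w)) (λ w → g (x ∷ w)) (tail-independent x))) (split (ind zero))
    where
    open ≡-Reasoning
    tail-independent : ∀ x → Independent-functions (λ w → f (x ∷ w)) (λ w → g (x ∷ w))
    tail-independent x i with ind (suc i)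
    ... | inj₁ p = inj₁ λ w → p (x ∷ w)
    ... | inj₂ p = inj₂ λ w → p (x ∷ w)
    E′ : (Vec ℕ (suc n) → ℚ) → ℕ → ℚ
    E′ h x = E (λ w → h (x ∷ w))
    -- The weight 0 is an arbitrary representative of the ignored first weight.
    factor : ∀ {h} → Ignores h zero → ∀ x → E′ h x ≡ E′ h 0
    factor ig x = E-cong λ w → ig (0 ∷ w) x
    average : ∀ {h} → Ignores h zero → E′ h 0 ≡ E h
    average {h} ig = sym (trans (cong (ε *_) (∑-cong N λ x _ → factor {h} ig x)) (average-const (E′ h 0)))
    split : Ignores f zero ⊎ Ignores g zero → ε * ∑ N (λ x → E′ f x * E′ g x) ≡ E f * E g
    split (inj₁ p) = begin
      ε * ∑ N (λ x → E′ f x * E′ g x)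
        ≡⟨ cong (ε *_) (∑-cong N λ x _ → cong (_* E′ g x) (factor {f} p x)) ⟩
      ε * ∑ N (λ x → E′ f 0 * E′ g x)
        ≡⟨ cong (ε *_) (∑-*ˡ N (E′ f 0) (E′ g)) ⟩
      ε * (E′ f 0 * ∑ N (E′ g))
        ≡⟨ solve 3 (λ e a s → e :* (a :* s) := a :* (e :* s)) refl ε (E′ f 0) (∑ N (E′ g)) ⟩
      E′ f 0 * E g
        ≡⟨ cong (_* E g) (average {f} p) ⟩
      E f * E g ∎
    split (inj₂ p) = begin
      ε * ∑ N (λ x → E′ f x * E′ g x)
        ≡⟨ cong (ε *_) (∑-cong N λ x _ →
             trans (cong (E′ f x *_) (factor {g} p x)) (ℚ.*-comm (E′ f x) (E′ g 0))) ⟩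
      ε * ∑ N (λ x → E′ g 0 * E′ f x)
        ≡⟨ cong (ε *_) (∑-*ˡ N (E′ g 0) (E′ f)) ⟩
      ε * (E′ g 0 * ∑ N (E′ f))
        ≡⟨ solve 3 (λ e a s → e :* (a :* s) := e :* s :* a) refl ε (E′ g 0) (∑ N (E′ f)) ⟩
      E f * E′ g 0
        ≡⟨ cong (E f *_) (average {g} p) ⟩
      E f * E g ∎

  E-∏ : ∀ {n} {A : Set} (F : A → Vec ℕ n → ℚ) {us} →
        AllPairs (λ u v → Independent-functions (F u) (F v)) us →
        E (λ w → ∏ us (λ u → F u w)) ≡ ∏ us (λ u → E (F u))
  E-∏ {n} F [] = E-const {n} 1ℚ
  E-∏ F {u ∷ us} (ind ∷ inds) = trans
    (E-independent (F u) (λ w → ∏ us (λ u → F u w)) (∏-independent {f = F u} {F = F} ind))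
    (cong (E (F u) *_) (E-∏ F inds))

  E-indicator : ∀ {n} (i : Fin n) {x} → x ℕ.< N → E (λ w → ⟦ lookup w i ≡ᵇ x ⟧) ≡ ε
  E-indicator {suc n} zero {x} x<N = begin
    ε * ∑ N (λ y → E {n} (λ _ → ⟦ y ≡ᵇ x ⟧))
      ≡⟨ cong (ε *_) (∑-cong N λ y _ → trans (E-const {n} ⟦ y ≡ᵇ x ⟧) (cong ⟦_⟧ (≡ᵇ-comm y x))) ⟩
    ε * ∑ N (λ y → ⟦ x ≡ᵇ y ⟧)
      ≡⟨ cong (ε *_) (trans (∑-indicator N x) (cong ⟦_⟧ (<ᵇ-true x<N))) ⟩
    ε * 1ℚ
      ≡⟨ ℚ.*-identityʳ ε ⟩
    ε ∎
    where open ≡-Reasoning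
  E-indicator {suc n} (suc i) x<N =
    trans (cong (ε *_) (∑-cong N λ _ _ → E-indicator i x<N)) (average-const ε)

  -- The indicators over x < N add up to at most 1 for every vector, including those with entries
  -- outside the range. An inequality is enough for a lower bound on `E f`.
  E-total : ∀ {n} (i : Fin n) (f : Vec ℕ n → ℚ) → (∀ w → 0ℚ ≤ f w) →
            ∑ N (λ x → E (λ w → ⟦ lookup w i ≡ᵇ x ⟧ * f w)) ≤ E f
  E-total i f 0≤f = subst (_≤ E f) (E-∑ N (λ x w → ⟦ lookup w i ≡ᵇ x ⟧ * f w)) (E-mono λ w →
    ℚ.≤-trans
      (ℚ.≤-reflexive (trans (∑-cong N λ x _ → ℚ.*-comm ⟦ lookup w i ≡ᵇ x ⟧ (f w))
        (trans (∑-*ˡ N (f w) (λ x → ⟦ lookup w i ≡ᵇ x ⟧)) (cong (f w *_) (∑-indicator N (lookup w i))))))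
      (subst (f w * ⟦ lookup w i <ᵇ N ⟧ ≤_) (ℚ.*-identityʳ (f w))
        (*-monoˡ (f w) (0≤f w) (⟦⟧≤1 (lookup w i <ᵇ N)))))

-- Trails in graphs of large girth

elements : ∀ {n} → Subset n → List (Fin n)
elements []          = []
elements (true  ∷ p) = zero ∷ map suc (elements p)
elements (false ∷ p) = map suc (elements p)

length-elements : ∀ {n} (p : Subset n) → length (elements p) ≡ card p
length-elements []          = refl
length-elements (true  ∷ p) = cong suc (trans (List.length-map suc (elements p)) (length-elements p))
length-elements (false ∷ p) = trans (List.length-map suc (elements p)) (length-elements p)

∈-elements⁺ : ∀ {n} {p : Subset n} {u} → u ∈ p → u ∈ˡ elements p
∈-elements⁺ here                         = here refl
∈-elements⁺ {p = true  ∷ p} (there u∈p) = there (∈-map⁺ suc (∈-elements⁺ u∈p))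
∈-elements⁺ {p = false ∷ p} (there u∈p) = ∈-map⁺ suc (∈-elements⁺ u∈p)

∈-elements⁻ : ∀ {n} {p : Subset n} {u} → u ∈ˡ elements p → u ∈ p
∈-elements⁻ {p = true  ∷ p} (here refl) = here
∈-elements⁻ {p = true  ∷ p} (there u∈) with _ , v∈ , refl ← ∈-map⁻ suc u∈ = there (∈-elements⁻ v∈)
∈-elements⁻ {p = false ∷ p} u∈         with _ , v∈ , refl ← ∈-map⁻ suc u∈ = there (∈-elements⁻ v∈)

elements-unique : ∀ {n} (p : Subset n) → Unique (elements p)
elements-unique []          = []
elements-unique (true  ∷ p) =
  All.map⁺ (All.universal (λ _ ()) (elements p)) ∷ Unique.map⁺ Fin.suc-injective (elements-unique p)
elements-unique (false ∷ p) = Unique.map⁺ Fin.suc-injective (elements-unique p)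

module _ {n : ℕ} where

  delete : Fin n → List (Fin n) → List (Fin n)
  delete p = filter (λ u → ¬? (u Fin.≟ p))

  length-delete-∈ : ∀ {p us} → Unique us → p ∈ˡ us → suc (length (delete p us)) ≡ length us
  length-delete-∈ {p} {u ∷ us} (u∉ ∷ us!) p∈ with u Fin.≟ p | p∈
  ... | yes refl | _          = cong (suc ∘ length) (List.filter-all _ (All.map ≢-sym u∉))
  ... | no  u≢p  | here p≡u   = contradiction (sym p≡u) u≢p
  ... | no  u≢p  | there p∈us = cong suc (length-delete-∈ us! p∈us)

  lookup-injective : ∀ {us : List (Fin n)} → Unique us →
                     ∀ i j → List.lookup us i ≡ List.lookup us j → i ≡ j
  lookup-injective (u∉ ∷ us!) zero    zero    eq = refl
  lookup-injective (u∉ ∷ us!) zero    (suc j) eq = contradiction eq (All.lookup u∉ (∈-lookup j))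
  lookup-injective (u∉ ∷ us!) (suc i) zero    eq = contradiction (sym eq) (All.lookup u∉ (∈-lookup i))
  lookup-injective (u∉ ∷ us!) (suc i) (suc j) eq = cong suc (lookup-injective us! i j eq)

module Trails (G : Graph) where
  open Graph G

  ~-sym : ∀ {u v} → u ~ v → v ~ u
  ~-sym = symmetric

  -- Trails are walks without backtracking.
  Extends : Node → List Node → Set
  Extends x []          = ⊤
  Extends x (y ∷ [])    = x ~ y
  Extends x (y ∷ z ∷ _) = x ~ y × x ≢ z

  Trail : List Node → Set
  Trail []       = ⊤
  Trail (x ∷ xs) = Extends x xs × Trail xs

  adjacent : ∀ {x y xs} → Trail (x ∷ y ∷ xs) → x ~ y
  adjacent {xs = []}    (x~y , _)       = x~y
  adjacent {xs = _ ∷ _} ((x~y , _) , _) = x~y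

  trail-step : ∀ {x} ys {zs} → Trail (x ∷ ys ++ zs) → ∀ i →
               List.lookup (x ∷ ys) (inject₁ i) ~ List.lookup (x ∷ ys) (suc i)
  trail-step (y ∷ ys) tr        zero    = adjacent tr
  trail-step (y ∷ ys) (_ , tr) (suc i) = trail-step ys tr i

  trail-last : ∀ {x} ys {z zs} → Trail (x ∷ ys ++ z ∷ zs) →
               List.lookup (x ∷ ys) (fromℕ (length ys)) ~ z
  trail-last []       tr       = adjacent tr
  trail-last (y ∷ ys) (_ , tr) = trail-last ys tr

  closed-trail⇒cycle : ∀ {x} ys {zs} → Trail (x ∷ ys ++ x ∷ zs) → Unique (x ∷ ys) → Cycle G
  closed-trail⇒cycle {x} ys tr x∷ys! = record
    { lastIndex = length ys
    ; node      = List.lookup (x ∷ ys)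
    ; distinct  = λ {i} {j} → lookup-injective x∷ys! i j
    ; step      = trail-step ys tr
    ; closing   = trail-last ys tr
    ; length≥3  = long ys tr
    }
    where
    -- A return after one step would be a loop, a return after two steps a backtrack.
    long : ∀ ys {zs} → Trail (x ∷ ys ++ x ∷ zs) → 3 ℕ.≤ suc (length ys)
    long []           tr              = contradiction (adjacent tr) irreflexive
    long (_ ∷ [])     ((_ , x≢x) , _) = contradiction refl x≢x
    long (_ ∷ _ ∷ ys) _               = s≤s (s≤s (s≤s z≤n))

  -- A first repetition would close a cycle shorter than the girth.
  short-trail-unique : ∀ {g} → GirthAtLeast g G → ∀ xs → Trail xs → length xs ℕ.≤ g → Unique xs
  short-trail-unique     girth []       tr  ≤g = []
  short-trail-unique {g} girth (x ∷ xs) tr  ≤g = All.tabulate fresh ∷ xs!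
    where
    xs! : Unique xs
    xs! = short-trail-unique girth xs (proj₂ tr) (ℕ.<⇒≤ ≤g)
    ++⁻ : ∀ ys {zs} → Unique (ys ++ x ∷ zs) → Unique (x ∷ ys)
    ++⁻ []       _        = [] ∷ []
    ++⁻ (y ∷ ys) (y∉ ∷ u) with x∉ys ∷ ys! ← ++⁻ ys u =
      (≢-sym (All.lookup (All.++⁻ʳ ys y∉) (here refl)) ∷ x∉ys) ∷ All.++⁻ˡ ys y∉ ∷ ys!
    no-return : ∀ {xs} → Trail (x ∷ xs) → Unique xs → length xs ℕ.< g → ¬ (x ∈ˡ xs)
    no-return tr xs! <g x∈xs with ys , zs , refl ← ∈-∃++ x∈xs =
      ℕ.<⇒≱ (ℕ.≤-<-trans
        (subst (suc (length ys) ℕ.≤_) (sym (trans (List.length-++ ys) (ℕ.+-suc (length ys) (length zs))))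
          (s≤s (ℕ.m≤m+n (length ys) (length zs)))) <g)
        (girth (closed-trail⇒cycle ys tr (++⁻ ys xs!)))
    fresh : ∀ {y} → y ∈ˡ xs → x ≢ y
    fresh y∈xs refl = no-return tr xs! ≤g y∈xs

  -- The tree explored from v when arriving from p; the root is explored with p = v.
  children : Node → Node → List Node
  children v p = delete p (elements (nbhd v))

  ∈-children⁻ : ∀ {u v p} → u ∈ˡ children v p → v ~ u × u ≢ p
  ∈-children⁻ u∈ with u∈nbhd , u≢p ← ∈-filter⁻ (λ u → ¬? (u Fin.≟ _)) u∈ = ∈-elements⁻ u∈nbhd , u≢p

  ∈-children⁺ : ∀ {u v p} → v ~ u → u ≢ p → u ∈ˡ children v p
  ∈-children⁺ v~u u≢p = ∈-filter⁺ (λ u → ¬? (u Fin.≟ _)) (∈-elements⁺ v~u) u≢p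

  children-unique : ∀ v p → Unique (children v p)
  children-unique v p = Unique.filter⁺ (λ u → ¬? (u Fin.≟ p)) (elements-unique (nbhd v))

  length-children : ∀ {v p} → v ~ p → suc (length (children v p)) ≡ degree v
  length-children {v} v~p = trans
    (length-delete-∈ (elements-unique (nbhd v)) (∈-elements⁺ v~p)) (length-elements (nbhd v))

  length-children-root : ∀ v → length (children v v) ≡ degree v
  length-children-root v = trans
    (cong length (List.filter-all (λ u → ¬? (u Fin.≟ v))
      (All.tabulate λ u∈ u≡v → irreflexive (subst (_∈ nbhd v) u≡v (∈-elements⁻ u∈)))))
    (length-elements (nbhd v))

  children⊆root : ∀ {v p} → children v p ⊆ children v v
  children⊆root u∈ with v~u , _ ← ∈-children⁻ u∈ =
    ∈-children⁺ v~u λ u≡v → irreflexive (subst (_∈ nbhd _) u≡v v~u)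

  -- The nodes explored from v to depth j. By `chosen-ignores`, the decision made on this tree
  -- depends on no other weights.
  Reach : ℕ → Node → Node → Node → Set
  Reach zero    v p y = y ≡ v
  Reach (suc j) v p y = y ≡ v ⊎ Any (λ u → Reach j u v y) (children v p)

  reach? : ∀ j v p y → Dec (Reach j v p y)
  reach? zero    v p y = y Fin.≟ v
  reach? (suc j) v p y = (y Fin.≟ v) ⊎-dec any? (λ u → reach? j u v y) (children v p)

  reach-refl : ∀ j {v p} → Reach j v p v
  reach-refl zero    = refl
  reach-refl (suc j) = inj₁ refl

  -- The path from v down to y is put in front of a trail that came to v from p; the condition u ≢ p
  -- on children rules out backtracking. The inclusion records that the old nodes survive.
  extend-trail : ∀ j {v p l y} → Trail (v ∷ p ∷ l) → Reach j v p y →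
    ∃ λ l′ → Trail (y ∷ l′) × length l′ ℕ.≤ j ℕ.+ suc (length l) × p ∷ l ⊆ l′
  extend-trail zero    {p = p} {l} tr refl        = p ∷ l , tr , ℕ.≤-refl , id
  extend-trail (suc j) {p = p} {l} tr (inj₁ refl) = p ∷ l , tr , ℕ.m≤n+m _ (suc j) , id
  extend-trail (suc j) {v} {p} {l} tr (inj₂ reach)
    with u , u∈ , r ← find reach
    with v~u , u≢p ← ∈-children⁻ u∈
    with l′ , tr′ , len , sub ← extend-trail j {u} {v} {p ∷ l} ((~-sym v~u , u≢p) , tr) r =
    l′ , tr′ , subst (length l′ ℕ.≤_) (ℕ.+-suc j (suc (length l))) len , sub ∘ there

  -- Here the path to y is read from the other end: with v at its head, it can be prolonged beyond v
  -- into another branch by `extend-trail`.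
  reach-trail : ∀ j {v u y} → v ~ u → Reach j u v y →
    ∃ λ l → Trail (v ∷ u ∷ l) × length l ℕ.≤ j × y ∈ˡ u ∷ l
  reach-trail zero    v~u refl        = [] , (v~u , tt , tt) , z≤n , here refl
  reach-trail (suc j) v~u (inj₁ refl) = [] , (v~u , tt , tt) , z≤n , here refl
  reach-trail (suc j) v~u (inj₂ reach)
    with w , w∈ , r ← find reach
    with u~w , w≢v ← ∈-children⁻ w∈
    with l , tr , len , y∈ ← reach-trail j u~w r =
    w ∷ l , ((v~u , ≢-sym w≢v) , tr) , s≤s len , there y∈

  module _ {g} (girth : GirthAtLeast g G) where

    repeats⇒long : ∀ {y l} → Trail (y ∷ l) → y ∈ˡ l → g ℕ.≤ length l
    repeats⇒long {y} {l} tr y∈l = ℕ.≮⇒≥ λ l<g → repeat (short-trail-unique girth (y ∷ l) tr l<g)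
      where
      repeat : ¬ Unique (y ∷ l)
      repeat (y∉ ∷ _) = All.lookup y∉ y∈l refl

    -- Otherwise the trail from y through u, v and u′ back to y repeats y.
    reach-disjoint : ∀ j {v p u u′ y} → 3 ℕ.+ (j ℕ.+ j) ℕ.≤ g →
      u ∈ˡ children v p → u′ ∈ˡ children v p → u ≢ u′ → Reach j u v y → ¬ Reach j u′ v y
    reach-disjoint j ≤g u∈ u′∈ u≢u′ r r′
      with v~u , _ ← ∈-children⁻ u∈
      with v~u′ , _ ← ∈-children⁻ u′∈
      with l , tr , len , y∈ ← reach-trail j v~u r
      with l′ , tr′ , len′ , sub ← extend-trail j ((~-sym v~u′ , ≢-sym u≢u′) , tr) r′ =
      -- The list behind y has at most j + (2 + j) nodes, one fewer than 3 + 2 j.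
      ℕ.<⇒≱ ≤g (ℕ.≤-trans (repeats⇒long tr′ (sub (there y∈)))
        (ℕ.≤-trans len′ (ℕ.≤-trans (ℕ.+-monoʳ-≤ j (s≤s (s≤s len)))
          (ℕ.≤-reflexive (trans (ℕ.+-suc j (suc j)) (cong suc (ℕ.+-suc j j)))))))

    -- A descent through u back to v would be a trail repeating v after at most j + 1 steps.
    parent-unreached : ∀ j {v p u} → 3 ℕ.+ (j ℕ.+ j) ℕ.≤ g → u ∈ˡ children v p → ¬ Reach j u v v
    parent-unreached j ≤g u∈ r
      with v~u , _ ← ∈-children⁻ u∈
      with l′ , tr′ , len′ , sub ← extend-trail j (~-sym v~u , tt , tt) r =
      ℕ.<⇒≱ ≤g (ℕ.≤-trans (repeats⇒long tr′ (sub (here refl)))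
        (ℕ.≤-trans len′ (ℕ.≤-trans (ℕ.≤-reflexive (ℕ.+-comm j 1))
          (s≤s (ℕ.≤-trans (ℕ.m≤m+n j j) (ℕ.n≤1+n (j ℕ.+ j)))))))

-- The truncated greedy rule and its independent sets

module Greedy (G : Graph) where
  open Graph G
  open Trails G

  Weights : Set
  Weights = Vec ℕ order

  -- Greedy decision at v on the tree of depth j explored from v; the decisions at
  -- depth j are replaced by a constant, chosen so that b = true overestimates and
  -- b = false underestimates the set of chosen nodes.
  chosen : Bool → ℕ → Node → Node → Weights → Bool
  chosen b zero    v p w = b
  chosen b (suc j) v p w =
    all (λ u → compatible (lookup w v) (lookup w u) (chosen (not b) j u v w)) (children v p)

  lookup-ignores : ∀ {i v : Node} → i ≢ v → Ignores (λ w → lookup w v) i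
  lookup-ignores i≢v w a = Vec.lookup∘update′ (≢-sym i≢v) w a

  chosen-ignores : ∀ b j {v p i} → ¬ Reach j v p i → Ignores (chosen b j v p) i
  chosen-ignores b zero    ∌i w a = refl
  chosen-ignores b (suc j) {v} {p} {i} ∌i w a = cong and (List.map-cong-local children-ignore)
    where
    ∌child : ∀ {u} → u ∈ˡ children v p → ¬ Reach j u v i
    ∌child u∈ r = ∌i (inj₂ (Any.map (λ { refl → r }) u∈))
    child-ignores : ∀ {u} → u ∈ˡ children v p →
      compatible (lookup (w [ i ]≔ a) v) (lookup (w [ i ]≔ a) u) (chosen (not b) j u v (w [ i ]≔ a))
      ≡ compatible (lookup w v) (lookup w u) (chosen (not b) j u v w)
    child-ignores {u} u∈
      rewrite lookup-ignores {i} {v} (∌i ∘ inj₁) w a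
            | lookup-ignores {i} {u} (λ { refl → ∌child u∈ (reach-refl j) }) w a
            | chosen-ignores (not b) j {u} {v} {i} (∌child u∈) w a = refl
    children-ignore = All.tabulate child-ignores

  selection : ℕ → Weights → Subset order
  selection j w = tabulate λ v → chosen false (suc j) v v w

  module _ (w : Weights) where

    -- Acceptance at v depends antitonically on the children's decisions, and passing to fewer
    -- children removes constraints.
    chosen-antitone : ∀ b b′ j j′ {v p p′} → children v p ⊆ children v p′ →
      (∀ {u} → T (chosen (not b′) j′ u v w) → T (chosen (not b) j u v w)) →
      T (chosen b (suc j) v p′ w) → T (chosen b′ (suc j′) v p w)
    chosen-antitone b b′ j j′ {v} {p} {p′} sub h c = All.all⁻ _ (All.tabulate λ {u} u∈ →
      compatible-antitone (lookup w v) (lookup w u) (h {u})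
        (All.lookup (All.all⁺ _ (children v p′) c) (sub u∈)))

    -- Every level negates the flag, so two statements alternate in the induction. The depths differ
    -- by one because a neighbour that is a root at depth `suc j` is seen as a child at depth `j`.
    under⇒over  : ∀ j {v p p′} → children v p ⊆ children v p′ →
      T (chosen false (suc j) v p′ w) → T (chosen true j v p w)
    under⇒over′ : ∀ j {v p p′} → children v p ⊆ children v p′ →
      T (chosen false j v p′ w) → T (chosen true (suc j) v p w)

    under⇒over zero    sub = λ _ → tt
    under⇒over (suc j) {v} sub =
      chosen-antitone false true (suc j) j sub λ {u} → under⇒over′ j {u} {v} {v} id
    under⇒over′ zero    sub = λ ()
    under⇒over′ (suc j) {v} sub =
      chosen-antitone false true j (suc j) sub λ {u} → under⇒over j {u} {v} {v} id

    chosen-child : ∀ j {u v} → v ~ u → T (chosen false (suc j) v v w) →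
                   T (compatible (lookup w v) (lookup w u) (chosen true j u v w))
    chosen-child j {u} {v} v~u c = All.lookup (All.all⁺ _ (children v v) c)
      (∈-children⁺ v~u λ { refl → irreflexive v~u })

    blocked : ∀ j {u v} → v ~ u → lookup w u ℕ.< lookup w v →
              T (chosen false (suc j) u u w) → ¬ T (chosen false (suc j) v v w)
    blocked j {u} {v} v~u u<v cu cv = compatible-lower (chosen true j u v w) u<v
      (chosen-child j v~u cv) (under⇒over j {u} {v} {u} children⊆root cu)

    ∈-selection : ∀ j {v} → v ∈ selection j w → T (chosen false (suc j) v v w)
    ∈-selection j {v} v∈ =
      Equivalence.from T-≡ (trans (sym (Vec.lookup∘tabulate _ v)) (Vec.[]=⇒lookup v∈))

    -- Of two adjacent nodes the heavier one is accepted only if even the overestimate rejects the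
    -- lighter one, which contradicts acceptance of the lighter one by the underestimate. Equal
    -- weights block each other.
    selection-independent : ∀ j → Independent G (selection j w)
    selection-independent j u v u∈ v∈ u~v with ℕ.<-cmp (lookup w u) (lookup w v)
    ... | tri< u<v _ _ = blocked j (~-sym u~v) u<v (∈-selection j u∈) (∈-selection j v∈)
    ... | tri≈ _ eq _  =
      compatible-equal (chosen true j v u w) eq (chosen-child j u~v (∈-selection j u∈))
    ... | tri> _ _ v<u = blocked j u~v v<u (∈-selection j v∈) (∈-selection j u∈)

-- The expected size of the selection

allPairs-unique : ∀ {A : Set} {R : A → A → Set} {us : List A} → Unique us →
  (∀ {u v} → u ∈ˡ us → v ∈ˡ us → u ≢ v → R u v) → AllPairs R us
allPairs-unique []          r = []
allPairs-unique (u∉ ∷ us!) r =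
  All.tabulate (λ v∈ → r (here refl) (there v∈) (All.lookup u∉ v∈)) ∷
  allPairs-unique us! λ u∈ v∈ → r (there u∈) (there v∈)

module Sampling (ε : ℚ) (0≤ε : 0ℚ ≤ ε) (N : ℕ) (0<N : 0 ℕ.< N) (εN≡1 : ε * ι N ≡ 1ℚ) where
  open Expectation ε 0≤ε N εN≡1
  open Recursion ε 0≤ε N 0<N εN≡1

  E-size : ∀ {k n} (f : Fin n → Vec ℕ k → Bool) {a} → (∀ v → a ≤ E (λ w → ⟦ f v w ⟧)) →
           ι n * a ≤ E (λ w → ι (card (tabulate (λ v → f v w))))
  E-size {k} {zero}  f {a} a≤ = ℚ.≤-reflexive (trans (ℚ.*-zeroˡ a) (sym (E-const {k} 0ℚ)))
  E-size {k} {suc n} f {a} a≤ = begin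
    (ι n + 1ℚ) * a
      ≡⟨ solve 2 (λ i a → (i :+ con 1ℚ) :* a := a :+ i :* a) refl (ι n) a ⟩
    a + ι n * a
      ≤⟨ ℚ.+-mono-≤ (a≤ zero) (E-size (f ∘ suc) (a≤ ∘ suc)) ⟩
    E (λ w → ⟦ f zero w ⟧) + E (λ w → ι (card (tabulate (λ v → f (suc v) w))))
      ≡⟨ sym (E-+ (λ w → ⟦ f zero w ⟧) (λ w → ι (card (tabulate (λ v → f (suc v) w))))) ⟩
    E (λ w → ⟦ f zero w ⟧ + ι (card (tabulate (λ v → f (suc v) w))))
      ≡⟨ E-cong (λ w → count (f zero w) (tabulate (λ v → f (suc v) w))) ⟩
    E (λ w → ι (card (tabulate (λ v → f v w)))) ∎
    where
    open ℚ.≤-Reasoning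
    count : ∀ b (p : Subset n) → ⟦ b ⟧ + ι (card p) ≡ ι (card (b ∷ p))
    count true  p = ℚ.+-comm 1ℚ (ι (card p))
    count false p = ℚ.+-identityˡ (ι (card p))

  module _ (G : Graph) (m g : ℕ) (girth : GirthAtLeast g G)
           (regular : IsRegular (2 ℕ.+ m) G) where
    open Graph G
    open Trails G
    open Greedy G

    δ : Node → ℕ → Weights → ℚ
    δ v x w = ⟦ lookup w v ≡ᵇ x ⟧

    δ-ignores : ∀ {i v x} → i ≢ v → Ignores (δ v x) i
    δ-ignores {x = x} i≢v w a = cong (λ y → ⟦ y ≡ᵇ x ⟧) (lookup-ignores i≢v w a)

    -- One level of the recursion, with `subtree` as the induction hypothesis. It serves inner
    -- nodes, where p is the parent, as well as the root, where p = v.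
    module Branch (b : Bool) (j : ℕ) (v p : Node) (≤g : 3 ℕ.+ (j ℕ.+ j) ℕ.≤ g)
      (subtree : ∀ {u x} → u ∈ˡ children v p → x ℕ.< N →
        E (λ w → δ u x w * ⟦ chosen (not b) j u v w ⟧) ≡ ε * t m (not b) j x) where

      -- The weight of v is frozen at x, so that each factor depends on the subtree of u alone.
      F : ℕ → Node → Weights → ℚ
      F x u w = ⟦ compatible x (lookup w u) (chosen (not b) j u v w) ⟧

      F-ignores : ∀ {x u i} → ¬ Reach j u v i → Ignores (F x u) i
      F-ignores {x} {u} ∌i w a = cong₂ (λ y c → ⟦ compatible x y c ⟧)
        (lookup-ignores (λ { refl → ∌i (reach-refl j) }) w a) (chosen-ignores (not b) j ∌i w a)

      F-independent : ∀ x → AllPairs (λ u u′ → Independent-functions (F x u) (F x u′)) (children v p)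
      F-independent x = allPairs-unique (children-unique v p) independent
        where
        independent : ∀ {u u′} → u ∈ˡ children v p → u′ ∈ˡ children v p → u ≢ u′ →
                      Independent-functions (F x u) (F x u′)
        independent {u} u∈ u′∈ u≢u′ i with reach? j u v i
        ... | yes r = inj₂ (F-ignores (reach-disjoint girth j ≤g u∈ u′∈ u≢u′ r))
        ... | no ∌i = inj₁ (F-ignores ∌i)

      δ-independent : ∀ x → Independent-functions (δ v x) (λ w → ∏ (children v p) (λ u → F x u w))
      δ-independent x = ∏-independent {F = F x} (All.tabulate independent)
        where
        independent : ∀ {u} → u ∈ˡ children v p → Independent-functions (δ v x) (F x u)
        independent u∈ i with i Fin.≟ v
        ... | yes refl = inj₂ (F-ignores (parent-unreached girth j ≤g u∈))
        ... | no  i≢v  = inj₁ (δ-ignores i≢v)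

      -- Take expectations in `⟦compatible⟧` and solve for the first term; `subtree` evaluates the
      -- sum over the earlier weights.
      E-F : ∀ {x u} → x ℕ.< N → u ∈ˡ children v p → E (F x u) ≡ Φ (t m (not b) j) x
      E-F {x} {u} x<N u∈ = begin
        E (F x u)
          ≡⟨ solve 3 (λ a e s → a := a :+ (e :+ s) :- e :- s) refl (E (F x u)) ε (ε * ∑ x s) ⟩
        E (F x u) + (ε + ε * ∑ x s) - ε - ε * ∑ x s
          ≡⟨ cong (λ q → q - ε - ε * ∑ x s) total ⟩
        1ℚ - ε - ε * ∑ x s ∎
        where
        open ≡-Reasoning
        s : ℕ → ℚ
        s = t m (not b) j
        earlier : Weights → ℚ
        earlier w = ∑ x (λ y → δ u y w * ⟦ chosen (not b) j u v w ⟧)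
        E-earlier : E earlier ≡ ε * ∑ x s
        E-earlier = trans (E-∑ x (λ y w → δ u y w * ⟦ chosen (not b) j u v w ⟧))
          (trans (∑-cong x λ y y<x → subtree u∈ (ℕ.<-trans y<x x<N)) (∑-*ˡ x ε s))
        total : E (F x u) + (ε + ε * ∑ x s) ≡ 1ℚ
        total = begin
          E (F x u) + (ε + ε * ∑ x s)
            ≡⟨ cong (λ s → E (F x u) + s) (sym (cong₂ _+_ (E-indicator u x<N) E-earlier)) ⟩
          E (F x u) + (E (δ u x) + E earlier)
            ≡⟨ cong (λ s → E (F x u) + s) (sym (E-+ (δ u x) earlier)) ⟩
          E (F x u) + E (λ w → δ u x w + earlier w)
            ≡⟨ sym (E-+ (F x u) (λ w → δ u x w + earlier w)) ⟩
          E (λ w → F x u w + (δ u x w + earlier w))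
            ≡⟨ E-cong (λ w → ⟦compatible⟧ x (lookup w u) (chosen (not b) j u v w)) ⟩
          E {order} (λ _ → 1ℚ)
            ≡⟨ E-const {order} 1ℚ ⟩
          1ℚ ∎

      branch : ∀ {x} → x ℕ.< N → E (λ w → δ v x w * ⟦ chosen b (suc j) v p w ⟧)
                                 ≡ ε * Φ (t m (not b) j) x ^ length (children v p)
      branch {x} x<N = begin
        E (λ w → δ v x w * ⟦ chosen b (suc j) v p w ⟧)
          ≡⟨ E-cong pointwise ⟩
        E (λ w → δ v x w * ∏ (children v p) (λ u → F x u w))
          ≡⟨ E-independent (δ v x) (λ w → ∏ (children v p) (λ u → F x u w)) (δ-independent x) ⟩
        E (δ v x) * E (λ w → ∏ (children v p) (λ u → F x u w))
          ≡⟨ cong₂ _*_ (E-indicator v x<N) (E-∏ (F x) (F-independent x)) ⟩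
        ε * ∏ (children v p) (λ u → E (F x u))
          ≡⟨ cong (ε *_) (∏-const (All.tabulate (E-F x<N))) ⟩
        ε * Φ (t m (not b) j) x ^ length (children v p) ∎
        where
        open ≡-Reasoning
        pointwise : ∀ w → δ v x w * ⟦ chosen b (suc j) v p w ⟧
                        ≡ δ v x w * ∏ (children v p) (λ u → F x u w)
        -- If the weight of v is not x, both sides vanish; otherwise freezing it at x changes
        -- nothing.
        pointwise w with lookup w v ≡ᵇ x in eq
        ... | false = trans (ℚ.*-zeroˡ ⟦ chosen b (suc j) v p w ⟧)
                        (sym (ℚ.*-zeroˡ (∏ (children v p) (λ u → F x u w))))
        ... | true  rewrite sym (ℕ.≡ᵇ⇒≡ (lookup w v) x (subst T (sym eq) _)) =
          cong (1ℚ *_) (⟦all⟧ _ (children v p))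

    -- Working jointly with the event that v has weight x avoids conditional probabilities and
    -- produces the factor ε. Removing the parent leaves `suc m` children.
    E-chosen : ∀ b j {v p x} → v ~ p → 1 ℕ.+ (j ℕ.+ j) ℕ.≤ g → x ℕ.< N →
               E (λ w → δ v x w * ⟦ chosen b j v p w ⟧) ≡ ε * t m b j x
    E-chosen b zero {v} v~p ≤g x<N = trans
      (E-independent (δ v _) (λ _ → ⟦ b ⟧) (λ _ → inj₂ λ _ _ → refl))
      (cong₂ _*_ (E-indicator v x<N) (E-const {order} ⟦ b ⟧))
    E-chosen b (suc j) {v} {p} {x} v~p ≤g x<N = trans
      (Branch.branch b j v p ≤g′ (λ u∈ → E-chosen (not b) j (~-sym (proj₁ (∈-children⁻ u∈)))
        (ℕ.≤-trans (ℕ.m≤n+m _ 2) ≤g′)) x<N)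
      (cong (λ k → ε * Φ (t m (not b) j) x ^ k)
        (ℕ.suc-injective (trans (length-children v~p) (regular v))))
      where
      ≤g′ : 3 ℕ.+ (j ℕ.+ j) ℕ.≤ g
      ≤g′ = subst (λ k → 2 ℕ.+ k ℕ.≤ g) (ℕ.+-suc j j) ≤g

    E-selection : ∀ j → 3 ℕ.+ (j ℕ.+ j) ℕ.≤ g → ∀ v →
                  root-sum m true j ≤ E (λ w → ⟦ chosen false (suc j) v v w ⟧)
    E-selection j ≤g v = begin
      ε * ∑ N (λ x → Φ (t m true j) x ^ (2 ℕ.+ m))
        ≡⟨ sym (∑-*ˡ N ε (λ x → Φ (t m true j) x ^ (2 ℕ.+ m))) ⟩
      ∑ N (λ x → ε * Φ (t m true j) x ^ (2 ℕ.+ m))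
        ≡⟨ sym (∑-cong N at-root) ⟩
      ∑ N (λ x → E (λ w → δ v x w * ⟦ chosen false (suc j) v v w ⟧))
        ≤⟨ E-total v (λ w → ⟦ chosen false (suc j) v v w ⟧)
             (λ w → 0≤⟦⟧ (chosen false (suc j) v v w)) ⟩
      E (λ w → ⟦ chosen false (suc j) v v w ⟧) ∎
      where
      open ℚ.≤-Reasoning
      at-root : ∀ x → x ℕ.< N → E (λ w → δ v x w * ⟦ chosen false (suc j) v v w ⟧)
                                ≡ ε * Φ (t m true j) x ^ (2 ℕ.+ m)
      at-root x x<N = trans
        (Branch.branch false j v v ≤g (λ u∈ → E-chosen true j (~-sym (proj₁ (∈-children⁻ u∈)))
          (ℕ.≤-trans (ℕ.m≤n+m _ 2) ≤g)) x<N)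
        (cong (λ k → ε * Φ (t m true j) x ^ k) (trans (length-children-root v) (regular v)))

    -- First-moment argument: the selection is independent for every choice of weights, so its
    -- average size cannot exceed the maximum.
    independence-number-bound : ∀ j → 3 ℕ.+ (j ℕ.+ j) ℕ.≤ g →
                                ι order * root-sum m true j ≤ ι (card (𝓘 G))
    independence-number-bound j ≤g = begin
      ι order * root-sum m true j
        ≤⟨ E-size (λ v → chosen false (suc j) v v) (E-selection j ≤g) ⟩
      E (λ w → ι (card (selection j w)))
        ≤⟨ E-mono (λ w → ι-mono (proj₂ (proj₂ (maximumIndependentSet G)) (selection j w)
             (selection-independent w j))) ⟩
      E {order} (λ _ → ι (card (𝓘 G)))
        ≡⟨ E-const {order} (ι (card (𝓘 G))) ⟩
      ι (card (𝓘 G)) ∎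
      where open ℚ.≤-Reasoning

-- From rational inequalities to the lower cut

toℚᵘ-ι : ∀ n → toℚᵘ (ι n) ℚᵘ.≃ mkℚᵘ (+ n) 0
toℚᵘ-ι zero    = ℚᵘ.≃-refl
toℚᵘ-ι (suc n) = ℚᵘ.≃-trans (ℚ.toℚᵘ-homo-+ (ι n) 1ℚ)
  (ℚᵘ.≃-trans (ℚᵘ.+-congˡ (mkℚᵘ (+ 1) 0) (toℚᵘ-ι n))
    (*≡* (cong (ℤ._* + 1)
      (trans (cong (ℤ._+ + 1) (ℤ.*-identityʳ (+ n))) (cong +_ (ℕ.+-comm n 1))))))

-- Permits cross-multiplication whatever the reduced form of the fraction is.
/-*-ι : ∀ a b .{{_ : ℕ.NonZero b}} → (+ a / b) * ι b ≡ ι a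
/-*-ι a b@(suc b′) = ℚ.toℚᵘ-injective (begin
  toℚᵘ ((+ a / b) * ι b)            ≈⟨ ℚ.toℚᵘ-homo-* (+ a / b) (ι b) ⟩
  toℚᵘ (+ a / b) ℚᵘ.* toℚᵘ (ι b)    ≈⟨ ℚᵘ.*-cong (ℚ.toℚᵘ-fromℚᵘ (mkℚᵘ (+ a) b′)) (toℚᵘ-ι b) ⟩
  mkℚᵘ (+ a) b′ ℚᵘ.* mkℚᵘ (+ b) 0   ≈⟨ *≡* (trans (ℤ.*-identityʳ _)
    (cong (λ n → + a ℤ.* + n) (sym (ℕ.*-identityʳ b)))) ⟩
  mkℚᵘ (+ a) 0                      ≈⟨ ℚᵘ.≃-sym (toℚᵘ-ι a) ⟩
  toℚᵘ (ι a)                        ∎)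
  where open ℚᵘ.≃-Reasoning

ι≡/1 : ∀ n → ι n ≡ + n / 1
ι≡/1 n = trans (sym (/-*-ι n 1)) (ℚ.*-identityʳ (+ n / 1))

0<ι-suc : ∀ n → 0ℚ < ι (suc n)
0<ι-suc n = ℚ.≤-<-trans (0≤ι n) (subst (_< ι (suc n)) (ℚ.+-identityʳ (ι n)) (ℚ.+-monoʳ-< (ι n) (ℚ.positive⁻¹ 1ℚ)))

*-ι-cancel : ∀ {p q} n .{{_ : ℕ.NonZero n}} → p * ι n ≤ q * ι n → p ≤ q
*-ι-cancel (suc n) = ℚ.*-cancelʳ-≤-pos (ι (suc n)) {{positive (0<ι-suc n)}}

0≤/ : ∀ a b .{{_ : ℕ.NonZero b}} → 0ℚ ≤ + a / b
0≤/ a b = *-ι-cancel b (subst₂ _≤_ (sym (ℚ.*-zeroˡ (ι b))) (sym (/-*-ι a b)) (0≤ι a))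

archimedean : ∀ {δ} → 0ℚ < δ → ∃ λ N → ∃ λ ε → 0 ℕ.< N × 0ℚ ≤ ε × ε * ι N ≡ 1ℚ × ε ≤ δ
-- A positive fraction is at least the reciprocal of its denominator.
archimedean {δ@(mkℚ (+ suc a) d _)} 0<δ = suc d , + 1 / suc d , s≤s z≤n , 0≤/ 1 (suc d) , /-*-ι 1 (suc d) ,
  *-ι-cancel (suc d) (subst₂ _≤_ (sym (/-*-ι 1 (suc d)))
    (trans (sym (/-*-ι (suc a) (suc d))) (cong (_* ι (suc d)) (ℚ.↥p/↧p≡p δ)))
    (ι-mono {1} {suc a} (s≤s z≤n)))
archimedean {mkℚ (+ zero)  _ _} 0<δ with () ← positive 0<δ
archimedean {mkℚ -[1+ _ ] _ _} 0<δ with () ← positive 0<δ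

^-* : ∀ p m n → (p ^ m) ^ n ≡ p ^ (n ℕ.* m)
^-* p m zero    = refl
^-* p m (suc n) = trans (cong (p ^ m *_) (^-* p m n)) (sym (^-+ p m (n ℕ.* m)))
  where
  ^-+ : ∀ p m n → p ^ (m ℕ.+ n) ≡ p ^ m * p ^ n
  ^-+ p zero    n = sym (ℚ.*-identityˡ (p ^ n))
  ^-+ p (suc m) n = trans (cong (p *_) (^-+ p m n)) (sym (ℚ.*-assoc p (p ^ m) (p ^ n)))

0<^ : ∀ {p} n → 0ℚ < p → 0ℚ < p ^ n
0<^ zero        0<p = ℚ.positive⁻¹ 1ℚ
0<^ {p} (suc n) 0<p = ℚ.positive⁻¹ (p ^ suc n)
  {{ℚ.pos*pos⇒pos p {{positive 0<p}} (p ^ n) {{positive (0<^ n 0<p)}}}}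

^-mono-< : ∀ {p q} n → 0ℚ ≤ p → p < q → p ^ suc n < q ^ suc n
^-mono-< {p} {q} n 0≤p p<q = ℚ.≤-<-trans
  (*-monoˡ p 0≤p (^-mono n 0≤p (ℚ.<⇒≤ p<q)))
  (ℚ.*-monoˡ-<-pos (q ^ n) {{positive (0<^ n (ℚ.≤-<-trans 0≤p p<q))}} p<q)

-- Comparison with negative fractional powers

module _ (β : ℚ) .{{β>0 : Positive β}} where

  private instance
    β≢0 : NonZero β
    β≢0 = ℚ.pos⇒nonZero β

  0≤1/β : 0ℚ ≤ 1/ β
  0≤1/β = ℚ.nonNegative⁻¹ (1/ β) {{ℚ.pos⇒nonNeg (1/ β) {{ℚ.1/pos⇒pos β}}}}

  -- i / n is the fraction -2 / (n c) in which a common factor c has been cancelled.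
  ^<^ᶻ : ∀ i n c {y} → i ℤ.* + c ≡ -[1+ 1 ] → 0ℚ ≤ y →
         y ^ (n ℕ.* c) < (1/ β) ^ 2 → y ^ n < β ^ᶻ i
  ^<^ᶻ (+ a) n c ac≡-2 with () ← trans (ℤ.pos-* a c) ac≡-2
  -- Otherwise raising to the power c, where (a + 1) c = 2, would contradict the hypothesis.
  ^<^ᶻ -[1+ a ] n c {y} ac≡-2 0≤y y<  = ℚ.≰⇒> λ ≤y → ℚ.<-irrefl refl (ℚ.<-≤-trans y<
    (subst₂ _≤_ (trans (^-* (1/ β) (suc a) c) (cong ((1/ β) ^_) (trans (ℕ.*-comm c (suc a)) ac≡2)))
      (trans (^-* y n c) (cong (y ^_) (ℕ.*-comm c n)))
      (^-mono c (0≤^ (suc a) 0≤1/β) ≤y)))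
    where
    ac≡2 : suc a ℕ.* c ≡ 2
    ac≡2 = trans (sym (ℤ.abs-* -[1+ a ] (+ c))) (cong ℤ.∣_∣ ac≡-2)

  -- Membership of y in the lower cut of β ^ (-2/n).
  ^<^ᶻ-/ : ∀ n .{{_ : ℕ.NonZero n}} {y} → 0ℚ ≤ y → y ^ n < (1/ β) ^ 2 →
           y ^ (↧ₙ (-[1+ 1 ] / n)) < β ^ᶻ (↥ (-[1+ 1 ] / n))
  ^<^ᶻ-/ n {y} 0≤y y< = ^<^ᶻ (↥ e) (↧ₙ e) ℤ.∣ ℤ.gcd -[1+ 1 ] (+ n) ∣ (ℚ.↥-/ -[1+ 1 ] n) 0≤y
    (subst (λ k → y ^ k < (1/ β) ^ 2) (sym
      (ℤ.+-injective (trans (ℤ.pos-* (↧ₙ e) _) (ℚ.↧-/ -[1+ 1 ] n)))) y<)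
    where e = -[1+ 1 ] / n

  -- States z² ≤ β^(-2/n) without roots, by squaring zⁿ ≤ 1 / β.
  square-≤ : ∀ {z} n → 0ℚ ≤ z → z ^ n * β ≤ 1ℚ → (z * z) ^ n ≤ (1/ β) ^ 2
  square-≤ {z} n 0≤z ≤1 = subst₂ _≤_ (sym (^-distrib-* z z n))
    (cong (1/ β *_) (sym (ℚ.*-identityʳ (1/ β)))) (*-mono (0≤^ n 0≤z) 0≤1/β z≤ z≤)
    where
    z≤ : z ^ n ≤ 1/ β
    z≤ = ℚ.*-cancelʳ-≤-pos β (subst (z ^ n * β ≤_) (sym (ℚ.*-inverseˡ β)) ≤1)

-- The bound for a single graph, with r = 3 + m

module _ (G : Graph) (m j g : ℕ) (≤g : 3 ℕ.+ (j ℕ.+ j) ℕ.≤ g)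
         (girth : GirthAtLeast g G) (regular : IsRegular (3 ℕ.+ m) G) where
  open Graph G using (order)

  -- Letting N → ∞ absorbs the loss ε due to equal weights.
  decay-bound : ∀ {α c q} → α * ι order ≡ ι (card (𝓘 G)) →
    ι (3 ℕ.+ m) * ι (2 ℕ.+ m) ^ j ≤ c * ι ((2 ℕ.+ j) !) → α < q →
    ∃ λ z → 0ℚ ≤ z × 1ℚ - (q + c) * (1ℚ + 1ℚ) < z * z × z ^ suc m * ι (2 ℕ.+ m) ≤ 1ℚ
  decay-bound {α} {c} {q} α≡ ≤c α<q
    -- The intermediate q′ gives ε + α ≤ q′ < q, which keeps the inequality strict.
    with q′ , α<q′ , q′<q ← ℚ.<-dense α<q
    with N , ε , 0<N , 0≤ε , εN≡1 , ε≤ ← archimedean {q′ - α}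
           (subst (_< q′ - α) (ℚ.+-inverseʳ α) (ℚ.+-monoˡ-< (- α) α<q′)) =
    z (suc m) N , proj₁ (z-range (suc m) N) , y<z² , z-N (suc m)
    where
    open Recursion ε 0≤ε N 0<N εN≡1
    open Sampling ε 0≤ε N 0<N εN≡1
    s = root-sum (suc m) true j
    s≤α : s ≤ α
    s≤α = *-ι-cancel order (subst₂ _≤_ (ℚ.*-comm (ι order) s) (sym α≡)
      (independence-number-bound G (suc m) g girth regular j ≤g))
    e = ι (3 ℕ.+ m) * ι (2 ℕ.+ m) ^ j * W (2 ℕ.+ j) N
    e≤c : e ≤ c
    e≤c = *-ι-cancel ((2 ℕ.+ j) !) {{(2 ℕ.+ j) ℕ.!≢0}} (begin
      e * ι ((2 ℕ.+ j) !)
        ≡⟨ ℚ.*-assoc (ι (3 ℕ.+ m) * ι (2 ℕ.+ m) ^ j) (W (2 ℕ.+ j) N) (ι ((2 ℕ.+ j) !)) ⟩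
      ι (3 ℕ.+ m) * ι (2 ℕ.+ m) ^ j * (W (2 ℕ.+ j) N * ι ((2 ℕ.+ j) !))
        ≤⟨ *-monoˡ _ (0≤* (0≤ι (3 ℕ.+ m)) (0≤^ j (0≤ι (2 ℕ.+ m)))) (W-N (2 ℕ.+ j)) ⟩
      ι (3 ℕ.+ m) * ι (2 ℕ.+ m) ^ j * 1ℚ
        ≡⟨ ℚ.*-identityʳ (ι (3 ℕ.+ m) * ι (2 ℕ.+ m) ^ j) ⟩
      ι (3 ℕ.+ m) * ι (2 ℕ.+ m) ^ j
        ≤⟨ ≤c ⟩
      c * ι ((2 ℕ.+ j) !) ∎)
      where open ℚ.≤-Reasoning
    total< : ε + s + e < q + c
    total< = ℚ.+-mono-<-≤ (ℚ.≤-<-trans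
      (subst (ε + s ≤_) (solve 2 (λ a b → a :- b :+ b := a) refl q′ α)
        (ℚ.+-mono-≤ ε≤ s≤α)) q′<q) e≤c
    y<z² : 1ℚ - (q + c) * (1ℚ + 1ℚ) < z (suc m) N * z (suc m) N
    y<z² = ℚ.<-≤-trans
      (ℚ.+-monoʳ-< 1ℚ (ℚ.neg-antimono-< (ℚ.*-monoˡ-<-pos (1ℚ + 1ℚ) total<)))
      (subst (1ℚ - (ε + s + e) * (1ℚ + 1ℚ) ≤_)
        (solve 2 (λ a b → a :+ (con 1ℚ :+ con 1ℚ) :* b :- b :* (con 1ℚ :+ con 1ℚ) := a) refl
          (z (suc m) N * z (suc m) N) (ε + s + e))
        (ℚ.+-monoˡ-≤ (- ((ε + s + e) * (1ℚ + 1ℚ))) (root-sum-bound (suc m) true j)))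

-- With k = j + 1 both sides carry the factorial (j + 2)!, and the stated error term has one more
-- factor r - 1 than the recursion loses.
error-bound : ∀ m j {k} → k ≡ suc j → .{{_ : ℕ.NonZero ((k ℕ.+ 1) !)}} →
  ι (3 ℕ.+ m) * ι (2 ℕ.+ m) ^ j
  ≤ (+ ((3 ℕ.+ m) ℕ.* (2 ℕ.+ m) ℕ.^ k) / (k ℕ.+ 1) !) * ι ((2 ℕ.+ j) !)
error-bound m j {k} refl = subst₂ _≤_
  (trans (ι-* (3 ℕ.+ m) ((2 ℕ.+ m) ℕ.^ j)) (cong (ι (3 ℕ.+ m) *_) (ι-^ (2 ℕ.+ m) j)))
  (trans (sym (/-*-ι ((3 ℕ.+ m) ℕ.* (2 ℕ.+ m) ℕ.^ k) ((k ℕ.+ 1) !)))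
    (cong (λ i → (+ ((3 ℕ.+ m) ℕ.* (2 ℕ.+ m) ℕ.^ k) / (k ℕ.+ 1) !) * ι (i !)) (ℕ.+-comm k 1)))
  (ι-mono (ℕ.*-monoʳ-≤ (3 ℕ.+ m) (ℕ.^-monoʳ-≤ (2 ℕ.+ m) (ℕ.n≤1+n j))))

-- From g ≥ 4 the quotient is at least 1, and 2 (j + 1) ≤ g - 2 gives the depth condition.
depth : ∀ {g} → 4 ℕ.≤ g → ∃ λ j → (g ∸ 2) div 2 ≡ suc j × 3 ℕ.+ (j ℕ.+ j) ℕ.≤ g
depth {g} (s≤s (s≤s {n = h} 2≤h)) with h div 2 in eq | m/n*n≤m h 2 | /-monoˡ-≤ 2 2≤h
... | zero  | _   | 1≤0 = contradiction 1≤0 λ ()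
... | suc j | ≤h | _   = j , refl , s≤s (s≤s (ℕ.<⇒≤ (subst (ℕ._≤ h) (cong (2 ℕ.+_)
        (trans (ℕ.*-comm j 2) (cong (j ℕ.+_) (ℕ.+-identityʳ j)))) ≤h)))

module _ (m : ℕ) where

  β : ℚ
  β = + (2 ℕ.+ m) / 1

  instance
    β>0 : Positive β
    β>0 = ℚ.normalize-pos (2 ℕ.+ m) 1

  -- The lower cut of (r - 1)^(-2/(r-2)) for r = 3 + m, as `root` unfolds it.
  InLowerCut : ℚ → Set
  InLowerCut y = y < 0ℚ ⊎ (0ℚ ≤ y × y ^ (↧ₙ (-[1+ 1 ] / suc m)) < β ^ᶻ (↥ (-[1+ 1 ] / suc m)))

  below-root : ∀ {y z} → 0ℚ ≤ z → y < z * z → z ^ suc m * ι (2 ℕ.+ m) ≤ 1ℚ → InLowerCut y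
  below-root {y} {z} 0≤z y<z² z≤ with y ℚ.<? 0ℚ
  ... | yes y<0 = inj₁ y<0
  ... | no  y≮0 = inj₂ (ℚ.≮⇒≥ y≮0 , ^<^ᶻ-/ β (suc m) (ℚ.≮⇒≥ y≮0) (ℚ.<-≤-trans
      (^-mono-< m (ℚ.≮⇒≥ y≮0) y<z²)
      (square-≤ β (suc m) 0≤z (subst (λ b → z ^ suc m * b ≤ 1ℚ) (ι≡/1 (2 ℕ.+ m)) z≤))))

corollary4 : (g r : ℕ) → 4 ℕ.≤ g → (r≥3 : 3 ℕ.≤ r) →
    upper (bound g r r≥3) ≤↑ inf (λ (G : 𝓖 g r) → fromℚ (independenceRatio (𝓖.graph G)))
corollary4 g (suc (suc (suc m))) 4≤g (s≤s (s≤s (s≤s z≤n))) {q} (𝒢 , ratio<q) =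
  -- By definition of `bound`, q lies in its upper cut when 1 - (q + c) · 2, with c the error term,
  -- lies in the lower cut of the root.
  let open 𝓖 𝒢
      j , k≡1+j , ≤g = depth 4≤g
      z , 0≤z , y<z² , z≤ = decay-bound graph m j g ≤g girth regular
        (/-*-ι (card (𝓘 graph)) (Graph.order graph))
        (error-bound m j k≡1+j {{((g ∸ 2) div 2 ℕ.+ 1) ℕ.!≢0}}) ratio<q
  in below-root m 0≤z y<z² z≤
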